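{- Let $G$ be a finite simple undirected graph with $n$ vertices and $m\ge 1$ edges, let $\mu$ be the largest eigenvalue of its adjacency matrix, let $\beta=\frac{\mu n}{2m}$, and let $\chi(G)$ be its chromatic number. Then $$\chi(G)\le \frac{n}{\beta}.$$
   Context: The quantity $\beta = \mu/d = \frac{\mu n}{2m}$, where $d = 2m/n$ is the average degree, is a spectral measure of the irregularity of $G$. It is defined for graphs with at least one edge. -}

module Defs where

open import Level using (0ℓ)
open import Data.Nat as ℕ using (ℕ; suc)
import Data.Nat.Properties as ℕ
open import Data.Integer using (+_)
open import Data.Rational as ℚ using (ℚ; 0ℚ; 1ℚ; ½; ∣_∣)
import Data.Rational.Properties as ℚ
open import Data.Rational.Solver using (module +-*-Solver)
open import Data.Fin as Fin using (Fin)
open import Data.List.Base using (List; length; filter; cartesianProduct; allFin)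
open import Data.Vec.Functional using (Vector; foldr)
open import Data.Bool.Base using (if_then_else_)
open import Data.Product using (Σ-syntax; ∃-syntax; _×_; _,_)
open import Data.Sum using (_⊎_; inj₁; inj₂)
open import Relation.Nullary using (¬_; yes; no; contradiction)
open import Relation.Nullary.Decidable using (⌊_⌋; _×-dec_)
open import Relation.Binary using (Rel; Symmetric; Decidable)
open import Relation.Binary.PropositionalEquality
  using (_≡_; _≢_; refl; sym; trans; cong; cong₂; subst)

------------------------------------------------------------------------
-- Real numbers as Cauchy sequences of rationals with a modulus of
-- convergence.  Equality of reals is _≃_, not _≡_.

IsCauchy : (ℕ → ℚ) → Set
IsCauchy s = ∀ ε → 0ℚ ℚ.< ε →
  ∃[ N ] (∀ i j → N ℕ.≤ i → N ℕ.≤ j → ∣ s i ℚ.- s j ∣ ℚ.< ε)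

record ℝ : Set where
  constructor mkℝ
  field
    seq    : ℕ → ℚ
    cauchy : IsCauchy seq

open ℝ public

infix 4 _≃_ _≤_ _<_ _#_

_≃_ : Rel ℝ 0ℓ
x ≃ y = ∀ ε → 0ℚ ℚ.< ε →
  ∃[ N ] (∀ i → N ℕ.≤ i → ∣ seq x i ℚ.- seq y i ∣ ℚ.< ε)

_≤_ : Rel ℝ 0ℓ
x ≤ y = ∀ ε → 0ℚ ℚ.< ε → ∃[ N ] (∀ i → N ℕ.≤ i → seq x i ℚ.≤ seq y i ℚ.+ ε)

_<_ : Rel ℝ 0ℓ
x < y = ∃[ ε ] (0ℚ ℚ.< ε ×
  ∃[ N ] (∀ i → N ℕ.≤ i → seq x i ℚ.+ ε ℚ.≤ seq y i))

_#_ : Rel ℝ 0ℓ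
x # y = x < y ⊎ y < x

p≤∣p∣ : ∀ p → p ℚ.≤ ∣ p ∣
p≤∣p∣ p with ℚ.∣p∣≡p∨∣p∣≡-p p
... | inj₁ e = ℚ.≤-reflexive (sym e)
... | inj₂ e = ℚ.≤-trans p≤0 (ℚ.0≤∣p∣ p)
  where
  open +-*-Solver
  p≤0 : p ℚ.≤ 0ℚ
  p≤0 = subst (ℚ._≤ 0ℚ)
    (trans (cong ℚ.-_ e) (solve 1 (λ p → :- (:- p) := p) refl p))
    (ℚ.neg-antimono-≤ (ℚ.0≤∣p∣ p))

-p≤∣p∣ : ∀ p → ℚ.- p ℚ.≤ ∣ p ∣
-p≤∣p∣ p = subst (ℚ.- p ℚ.≤_) (ℚ.∣-p∣≡∣p∣ p) (p≤∣p∣ (ℚ.- p))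

half-pos : ∀ {ε} → 0ℚ ℚ.< ε → 0ℚ ℚ.< ½ ℚ.* ε
half-pos 0<ε = ℚ.*-monoʳ-<-pos ½ 0<ε

half+half : ∀ ε → ½ ℚ.* ε ℚ.+ ½ ℚ.* ε ≡ ε
half+half ε = trans (sym (ℚ.*-distribʳ-+ ε ½ ½)) (ℚ.*-identityˡ ε)

*-pos : ∀ {p q} → 0ℚ ℚ.< p → 0ℚ ℚ.< q → 0ℚ ℚ.< p ℚ.* q
*-pos {p} {q} 0<p 0<q = subst (ℚ._< p ℚ.* q) (ℚ.*-zeroʳ p)
  (ℚ.*-monoʳ-<-pos p {{ℚ.positive 0<p}} 0<q)

const-cauchy : ∀ q → IsCauchy (λ _ → q)
const-cauchy q ε 0<ε =
  0 , λ _ _ _ _ → subst (λ d → ∣ d ∣ ℚ.< ε) (sym (ℚ.+-inverseʳ q)) 0<ε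

+-cauchy : ∀ {s t} → IsCauchy s → IsCauchy t → IsCauchy (λ i → s i ℚ.+ t i)
+-cauchy {s} {t} cs ct ε 0<ε
  with cs (½ ℚ.* ε) (half-pos 0<ε) | ct (½ ℚ.* ε) (half-pos 0<ε)
... | M , hM | N , hN = M ℕ.⊔ N , λ i j hi hj → begin-strict
    ∣ (s i ℚ.+ t i) ℚ.- (s j ℚ.+ t j) ∣
      ≡⟨ cong ∣_∣ (solve 4 (λ a b c d → (a :+ b) :- (c :+ d) := (a :- c) :+ (b :- d))
           refl (s i) (t i) (s j) (t j)) ⟩
    ∣ (s i ℚ.- s j) ℚ.+ (t i ℚ.- t j) ∣
      ≤⟨ ℚ.∣p+q∣≤∣p∣+∣q∣ (s i ℚ.- s j) (t i ℚ.- t j) ⟩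
    ∣ s i ℚ.- s j ∣ ℚ.+ ∣ t i ℚ.- t j ∣
      <⟨ ℚ.+-mono-< (hM i j (ℕ.m⊔n≤o⇒m≤o M N hi) (ℕ.m⊔n≤o⇒m≤o M N hj))
                    (hN i j (ℕ.m⊔n≤o⇒n≤o M N hi) (ℕ.m⊔n≤o⇒n≤o M N hj)) ⟩
    ½ ℚ.* ε ℚ.+ ½ ℚ.* ε
      ≡⟨ half+half ε ⟩
    ε ∎
  where
  open ℚ.≤-Reasoning
  open +-*-Solver

bounded : ∀ {s} → IsCauchy s →
  ∃[ B ] (0ℚ ℚ.< B × ∃[ N ] (∀ i → N ℕ.≤ i → ∣ s i ∣ ℚ.≤ B))
bounded {s} cs with cs 1ℚ (ℚ.positive⁻¹ 1ℚ)
... | N , hN = 1ℚ ℚ.+ ∣ s N ∣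
             , ℚ.+-mono-<-≤ (ℚ.positive⁻¹ 1ℚ) (ℚ.0≤∣p∣ (s N))
             , N , λ i hi → begin
    ∣ s i ∣
      ≡⟨ cong ∣_∣ (solve 2 (λ a b → a := (a :- b) :+ b) refl (s i) (s N)) ⟩
    ∣ (s i ℚ.- s N) ℚ.+ s N ∣
      ≤⟨ ℚ.∣p+q∣≤∣p∣+∣q∣ (s i ℚ.- s N) (s N) ⟩
    ∣ s i ℚ.- s N ∣ ℚ.+ ∣ s N ∣
      ≤⟨ ℚ.+-monoˡ-≤ ∣ s N ∣ (ℚ.<⇒≤ (hN i N hi ℕ.≤-refl)) ⟩
    1ℚ ℚ.+ ∣ s N ∣ ∎
  where
  open ℚ.≤-Reasoning
  open +-*-Solver

shrink : ∀ {B} → 0ℚ ℚ.< B → ∀ {ε} → 0ℚ ℚ.< ε →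
  ∃[ δ ] (0ℚ ℚ.< δ × B ℚ.* δ ≡ ½ ℚ.* ε)
shrink {B} 0<B {ε} 0<ε =
  1/B ℚ.* (½ ℚ.* ε) , *-pos 0<1/B (half-pos 0<ε) ,
  trans (sym (ℚ.*-assoc B 1/B (½ ℚ.* ε)))
    (trans (cong (ℚ._* (½ ℚ.* ε)) (ℚ.*-inverseʳ B {{nz}})) (ℚ.*-identityˡ (½ ℚ.* ε)))
  where
  nz : ℚ.NonZero B
  nz = ℚ.pos⇒nonZero B {{ℚ.positive 0<B}}
  1/B : ℚ
  1/B = ℚ.1/_ B {{nz}}
  0<1/B : 0ℚ ℚ.< 1/B
  0<1/B = ℚ.positive⁻¹ 1/B {{ℚ.1/pos⇒pos B {{ℚ.positive 0<B}}}}

∣*∣-bound : ∀ {B δ} p q → 0ℚ ℚ.< B → ∣ p ∣ ℚ.≤ B → ∣ q ∣ ℚ.< δ →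
  ∣ p ℚ.* q ∣ ℚ.< B ℚ.* δ
∣*∣-bound {B} {δ} p q 0<B hp hq = begin-strict
    ∣ p ℚ.* q ∣      ≡⟨ ℚ.∣p*q∣≡∣p∣*∣q∣ p q ⟩
    ∣ p ∣ ℚ.* ∣ q ∣  ≤⟨ ℚ.*-monoʳ-≤-nonNeg ∣ q ∣ {{ℚ.nonNegative (ℚ.0≤∣p∣ q)}} hp ⟩
    B ℚ.* ∣ q ∣      <⟨ ℚ.*-monoʳ-<-pos B {{ℚ.positive 0<B}} hq ⟩
    B ℚ.* δ ∎
  where open ℚ.≤-Reasoning

*-difference : ∀ a b c d →
  a ℚ.* b ℚ.- c ℚ.* d ≡ b ℚ.* (a ℚ.- c) ℚ.+ c ℚ.* (b ℚ.- d)
*-difference = solve 4 (λ a b c d →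
  a :* b :- c :* d := b :* (a :- c) :+ c :* (b :- d)) refl
  where open +-*-Solver

*-estimate : ∀ {B C δ η ε} a b c d →
  0ℚ ℚ.< B → 0ℚ ℚ.< C → C ℚ.* δ ≡ ½ ℚ.* ε → B ℚ.* η ≡ ½ ℚ.* ε →
  ∣ c ∣ ℚ.≤ B → ∣ b ∣ ℚ.≤ C → ∣ a ℚ.- c ∣ ℚ.< δ → ∣ b ℚ.- d ∣ ℚ.< η →
  ∣ a ℚ.* b ℚ.- c ℚ.* d ∣ ℚ.< ε
*-estimate {B} {C} {δ} {η} {ε} a b c d 0<B 0<C Cδ Bη hc hb hac hbd = begin-strict
    ∣ a ℚ.* b ℚ.- c ℚ.* d ∣
      ≡⟨ cong ∣_∣ (*-difference a b c d) ⟩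
    ∣ b ℚ.* (a ℚ.- c) ℚ.+ c ℚ.* (b ℚ.- d) ∣
      ≤⟨ ℚ.∣p+q∣≤∣p∣+∣q∣ (b ℚ.* (a ℚ.- c)) (c ℚ.* (b ℚ.- d)) ⟩
    ∣ b ℚ.* (a ℚ.- c) ∣ ℚ.+ ∣ c ℚ.* (b ℚ.- d) ∣
      <⟨ ℚ.+-mono-< (∣*∣-bound b (a ℚ.- c) 0<C hb hac)
                    (∣*∣-bound c (b ℚ.- d) 0<B hc hbd) ⟩
    C ℚ.* δ ℚ.+ B ℚ.* η
      ≡⟨ cong₂ ℚ._+_ Cδ Bη ⟩
    ½ ℚ.* ε ℚ.+ ½ ℚ.* ε
      ≡⟨ half+half ε ⟩
    ε ∎
  where open ℚ.≤-Reasoning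

*-cauchy : ∀ {s t} → IsCauchy s → IsCauchy t → IsCauchy (λ i → s i ℚ.* t i)
*-cauchy {s} {t} cs ct ε 0<ε =
  let B , 0<B , K , hK = bounded {s} cs
      C , 0<C , L , hL = bounded {t} ct
      δ , 0<δ , Cδ     = shrink 0<C 0<ε
      η , 0<η , Bη     = shrink 0<B 0<ε
      M , hM           = cs δ 0<δ
      N , hN           = ct η 0<η
      K⊔L≤ : ∀ {i} → (K ℕ.⊔ L) ℕ.⊔ (M ℕ.⊔ N) ℕ.≤ i → K ℕ.⊔ L ℕ.≤ i
      K⊔L≤ = ℕ.m⊔n≤o⇒m≤o (K ℕ.⊔ L) (M ℕ.⊔ N)
      M⊔N≤ : ∀ {i} → (K ℕ.⊔ L) ℕ.⊔ (M ℕ.⊔ N) ℕ.≤ i → M ℕ.⊔ N ℕ.≤ i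
      M⊔N≤ = ℕ.m⊔n≤o⇒n≤o (K ℕ.⊔ L) (M ℕ.⊔ N)
  in (K ℕ.⊔ L) ℕ.⊔ (M ℕ.⊔ N) , λ i j hi hj →
    *-estimate (s i) (t i) (s j) (t j) 0<B 0<C Cδ Bη
      (hK j (ℕ.m⊔n≤o⇒m≤o K L (K⊔L≤ hj)))
      (hL i (ℕ.m⊔n≤o⇒n≤o K L (K⊔L≤ hi)))
      (hM i j (ℕ.m⊔n≤o⇒m≤o M N (M⊔N≤ hi)) (ℕ.m⊔n≤o⇒m≤o M N (M⊔N≤ hj)))
      (hN i j (ℕ.m⊔n≤o⇒n≤o M N (M⊔N≤ hi)) (ℕ.m⊔n≤o⇒n≤o M N (M⊔N≤ hj)))

fromℚ : ℚ → ℝ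
fromℚ q = mkℝ (λ _ → q) (const-cauchy q)

fromℕ : ℕ → ℝ
fromℕ k = fromℚ (+ k ℚ./ 1)

0ℝ 1ℝ : ℝ
0ℝ = fromℚ 0ℚ
1ℝ = fromℚ 1ℚ

infixl 6 _+_
infixl 7 _*_

_+_ : ℝ → ℝ → ℝ
x + y = mkℝ (λ i → seq x i ℚ.+ seq y i) (+-cauchy {seq x} {seq y} (cauchy x) (cauchy y))

_*_ : ℝ → ℝ → ℝ
x * y = mkℝ (λ i → seq x i ℚ.* seq y i) (*-cauchy {seq x} {seq y} (cauchy x) (cauchy y))

-- The value at 0 is immaterial: a sequence representing a real apart from 0
-- is eventually nonzero.
inv : ℚ → ℚ
inv q with q ℚ.≟ 0ℚ
... | yes _   = 0ℚ
... | no  q≢0 = ℚ.1/_ q {{ℚ.≢-nonZero q≢0}}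

inv-inverse : ∀ q → q ≢ 0ℚ → q ℚ.* inv q ≡ 1ℚ
inv-inverse q q≢0 with q ℚ.≟ 0ℚ
... | yes q≡0 = contradiction q≡0 q≢0
... | no  q≢0′ = ℚ.*-inverseʳ q {{ℚ.≢-nonZero q≢0′}}

BoundedAway : (ℕ → ℚ) → Set
BoundedAway s = ∃[ δ ] (0ℚ ℚ.< δ × ∃[ N ] (∀ i → N ℕ.≤ i → δ ℚ.≤ ∣ s i ∣))

#0⇒boundedAway : ∀ x → x # 0ℝ → BoundedAway (seq x)
#0⇒boundedAway x (inj₂ (δ , 0<δ , N , h)) = δ , 0<δ , N , λ i hi →
  ℚ.≤-trans (subst (ℚ._≤ seq x i) (ℚ.+-identityˡ δ) (h i hi)) (p≤∣p∣ (seq x i))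
#0⇒boundedAway x (inj₁ (δ , 0<δ , N , h)) = δ , 0<δ , N , λ i hi → begin
    δ                               ≡⟨ solve 2 (λ a d → d := :- a :+ (a :+ d)) refl (seq x i) δ ⟩
    ℚ.- seq x i ℚ.+ (seq x i ℚ.+ δ) ≤⟨ ℚ.+-monoʳ-≤ (ℚ.- seq x i) (h i hi) ⟩
    ℚ.- seq x i ℚ.+ 0ℚ              ≡⟨ ℚ.+-identityʳ (ℚ.- seq x i) ⟩
    ℚ.- seq x i                     ≤⟨ -p≤∣p∣ (seq x i) ⟩
    ∣ seq x i ∣ ∎
  where
  open ℚ.≤-Reasoning
  open +-*-Solver

inv-difference : ∀ p q a b →
  p ℚ.* q ℚ.* (a ℚ.- b) ≡ (p ℚ.* a) ℚ.* q ℚ.- (q ℚ.* b) ℚ.* p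
inv-difference = solve 4 (λ p q a b →
  p :* q :* (a :- b) := (p :* a) :* q :- (q :* b) :* p) refl
  where open +-*-Solver

inv-cauchy : ∀ {s} → IsCauchy s → BoundedAway s → IsCauchy (λ i → inv (s i))
inv-cauchy {s} cs (δ , 0<δ , M , hM) ε 0<ε
  with cs (δ ℚ.* δ ℚ.* ε) (*-pos (*-pos 0<δ 0<δ) 0<ε)
... | N , hN = M ℕ.⊔ N , λ i j hi hj →
      step (s i) (s j)
        (hM i (ℕ.m⊔n≤o⇒m≤o M N hi)) (hM j (ℕ.m⊔n≤o⇒m≤o M N hj))
        (hN j i (ℕ.m⊔n≤o⇒n≤o M N hj) (ℕ.m⊔n≤o⇒n≤o M N hi))
  where
  open ℚ.≤-Reasoning
  open +-*-Solver
  nonzero : ∀ p → δ ℚ.≤ ∣ p ∣ → p ≢ 0ℚ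
  nonzero p h refl = ℚ.<-irrefl refl (ℚ.<-≤-trans 0<δ h)
  step : ∀ p q → δ ℚ.≤ ∣ p ∣ → δ ℚ.≤ ∣ q ∣ → ∣ q ℚ.- p ∣ ℚ.< δ ℚ.* δ ℚ.* ε →
    ∣ inv p ℚ.- inv q ∣ ℚ.< ε
  step p q hp hq h =
    ℚ.*-cancelˡ-<-nonNeg (δ ℚ.* δ) {{ℚ.nonNegative (ℚ.<⇒≤ (*-pos 0<δ 0<δ))}} (begin-strict
      δ ℚ.* δ ℚ.* d
        ≤⟨ ℚ.*-monoʳ-≤-nonNeg d {{ℚ.nonNegative (ℚ.0≤∣p∣ (inv p ℚ.- inv q))}} δδ≤ ⟩
      ∣ p ∣ ℚ.* ∣ q ∣ ℚ.* d
        ≡⟨ cong (ℚ._* d) (sym (ℚ.∣p*q∣≡∣p∣*∣q∣ p q)) ⟩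
      ∣ p ℚ.* q ∣ ℚ.* d
        ≡⟨ sym (ℚ.∣p*q∣≡∣p∣*∣q∣ (p ℚ.* q) (inv p ℚ.- inv q)) ⟩
      ∣ p ℚ.* q ℚ.* (inv p ℚ.- inv q) ∣
        ≡⟨ cong ∣_∣ (inv-difference p q (inv p) (inv q)) ⟩
      ∣ (p ℚ.* inv p) ℚ.* q ℚ.- (q ℚ.* inv q) ℚ.* p ∣
        ≡⟨ cong₂ (λ u v → ∣ u ℚ.* q ℚ.- v ℚ.* p ∣)
             (inv-inverse p (nonzero p hp)) (inv-inverse q (nonzero q hq)) ⟩
      ∣ 1ℚ ℚ.* q ℚ.- 1ℚ ℚ.* p ∣
        ≡⟨ cong₂ (λ u v → ∣ u ℚ.- v ∣) (ℚ.*-identityˡ q) (ℚ.*-identityˡ p) ⟩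
      ∣ q ℚ.- p ∣
        <⟨ h ⟩
      δ ℚ.* δ ℚ.* ε ∎)
    where
    d : ℚ
    d = ∣ inv p ℚ.- inv q ∣
    δδ≤ : δ ℚ.* δ ℚ.≤ ∣ p ∣ ℚ.* ∣ q ∣
    δδ≤ = ℚ.≤-trans (ℚ.*-monoʳ-≤-nonNeg δ {{ℚ.nonNegative (ℚ.<⇒≤ 0<δ)}} hp)
                    (ℚ.*-monoˡ-≤-nonNeg ∣ p ∣ {{ℚ.nonNegative (ℚ.0≤∣p∣ p)}} hq)

infixl 7 _/_[_]

_/_[_] : ℝ → (y : ℝ) → y # 0ℝ → ℝ
x / y [ y#0 ] =
  x * mkℝ (λ i → inv (seq y i)) (inv-cauchy {seq y} (cauchy y) (#0⇒boundedAway y y#0))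

fromℕ#0 : ∀ {k} → 1 ℕ.≤ k → fromℕ k # 0ℝ
fromℕ#0 {suc k} _ = inj₂
  ( + suc k ℚ./ 1 , ℚ.positive⁻¹ (+ suc k ℚ./ 1) {{ℚ.normalize-pos (suc k) 1}}
  , 0 , λ _ _ → ℚ.≤-reflexive (ℚ.+-identityˡ (+ suc k ℚ./ 1)))

------------------------------------------------------------------------
-- Eigenvalues of real matrices

Matrix : ℕ → Set
Matrix n = Fin n → Fin n → ℝ

sum : ∀ {n} → Vector ℝ n → ℝ
sum = foldr _+_ 0ℝ

infixl 7 _*ᵥ_

_*ᵥ_ : ∀ {n} → Matrix n → Vector ℝ n → Vector ℝ n
(A *ᵥ v) i = sum (λ j → A i j * v j)

-- The eigenvalues of a real symmetric matrix are all real, so the largest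
-- eigenvalue is the largest one in ℝ.
IsEigenvalue : ∀ {n} → Matrix n → ℝ → Set
IsEigenvalue {n} A ev =
  ∃[ v ] (¬ (∀ (i : Fin n) → v i ≃ 0ℝ) × (∀ i → (A *ᵥ v) i ≃ ev * v i))

IsLargestEigenvalue : ∀ {n} → Matrix n → ℝ → Set
IsLargestEigenvalue A μ = IsEigenvalue A μ × (∀ ev → IsEigenvalue A ev → ev ≤ μ)

------------------------------------------------------------------------
-- Finite simple graphs

record SimpleGraph (n : ℕ) : Set₁ where
  field
    Adj    : Rel (Fin n) 0ℓ
    adj?   : Decidable Adj
    symm   : Symmetric Adj
    irrefl : ∀ i → ¬ Adj i i

module _ {n : ℕ} (G : SimpleGraph n) where
  open SimpleGraph G

  -- Each edge is listed once, as the pair of its endpoints in increasing order.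
  edges : List (Fin n × Fin n)
  edges = filter (λ (i , j) → (i Fin.<? j) ×-dec adj? i j)
                 (cartesianProduct (allFin n) (allFin n))

  numEdges : ℕ
  numEdges = length edges

  adjacencyMatrix : Matrix n
  adjacencyMatrix i j = if ⌊ adj? i j ⌋ then 1ℝ else 0ℝ

  Colorable : ℕ → Set
  Colorable k = Σ[ c ∈ (Fin n → Fin k) ] (∀ i j → Adj i j → c i ≢ c j)

  IsChromaticNumber : ℕ → Set
  IsChromaticNumber k = Colorable k × (∀ l → Colorable l → k ℕ.≤ l)

  irregularity : 1 ℕ.≤ numEdges → ℝ → ℝ
  irregularity m≥1 μ =
    (μ * fromℕ n) / fromℕ (2 ℕ.* numEdges)
      [ fromℕ#0 (ℕ.≤-trans m≥1 (ℕ.m≤n*m numEdges 2)) ]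

{-# OPTIONS --safe #-}

-- Since β = μ n / 2m, the claim is χ μ ≤ 2m.  In a colouring with χ colours any two colour classes are
-- joined by an edge, so χ (χ − 1) ≤ 2m, which suffices if μ ≤ χ − 1.  Otherwise χ μ ≤ μ² + μ, and
-- every eigenvalue satisfies μ² + μ ≤ 2m (Stanley): Cauchy–Schwarz in each row of Av = μv gives
-- μ² ∣v∣² ≤ 2m ∣v∣² − ∑ dᵢ vᵢ², and ∑ dᵢ vᵢ² ≥ vᵀAv = μ ∣v∣² since the Laplacian is positive
-- semidefinite.
--
-- That β is apart from 0 follows from μ ≥ 1, for which an eigenvalue ≥ 1 must be exhibited.  Bisection
-- on rational t, deciding by elimination whether t − A is positive definite, yields a real top ≥ 1
-- for which top − A is positive semidefinite but not coercive.  The same elimination over ℝ, with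
-- signs decided under double negation, shows that top − A has a kernel vector.  The double negation is
-- harmless because 1 ≤ μ is a stable proposition.
module Submission where

open import Level using (0ℓ)
open import Algebra.Bundles using (CommutativeRing)
import Algebra.Properties.Ring as RingProperties
import Algebra.Properties.Semiring.Sum as SemiringSum
import Algebra.Solver.Ring as RingSolver
open import Algebra.Solver.Ring.AlmostCommutativeRing
  using (fromCommutativeRing; _-Raw-AlmostCommutative⟶_)
open import Data.Bool.Base using (if_then_else_)
open import Data.Fin as Fin using (Fin; zero; suc; combine; join; punchIn; punchOut; remQuot; splitAt)
import Data.Fin.Properties as Fin
open import Data.Integer as ℤ using (+_; -[1+_])
import Data.Integer.Properties as ℤ
open import Data.List.Base as List
  using (_∷_; _++_; allFin; cartesianProduct; filter; length; lookup; tabulate)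
open import Data.List.Membership.Propositional using (_∈_)
open import Data.List.Membership.Propositional.Properties
  using (∈-allFin; ∈-cartesianProduct⁺; ∈-filter⁺; ∈-filter⁻)
import Data.List.Properties as List
import Data.List.Relation.Unary.Any as Any
import Data.List.Relation.Unary.Any.Properties as Any
open import Data.Maybe.Base using (Maybe; just; nothing)
open import Data.Nat as ℕ using (ℕ; zero; suc) renaming (_≤_ to _≤ℕ_)
import Data.Nat.Properties as ℕ
open import Data.Product using (Σ-syntax; ∃-syntax; _×_; _,_; proj₁; proj₂; swap)
open import Data.Rational as ℚ using (ℚ; mkℚ; 0ℚ; 1ℚ; ½; ∣_∣)
import Data.Rational.Properties as ℚ
open import Data.Rational.Solver using (module +-*-Solver)
import Data.Rational.Unnormalised as ℚᵘ
import Data.Rational.Unnormalised.Properties as ℚᵘ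
open import Data.Sum using (_⊎_; inj₁; inj₂; [_,_]′)
open import Data.Vec.Functional using (Vector; tail)
open import Function using (id; _∘_)
open import Function.Definitions using (Injective)
open import Relation.Binary using (tri<; tri≈; tri>)
open import Relation.Binary.PropositionalEquality as ≡ using (_≡_; _≢_)
open import Relation.Nullary using (¬_; Dec; yes; no; contradiction)
open import Relation.Nullary.Decidable using (⌊_⌋; _×-dec_)
open import Relation.Unary using (Pred; Decidable)
open import Defs
  using (SimpleGraph; numEdges; IsCauchy; *-pos; half-pos; half+half; inv; inv-inverse; p≤∣p∣; shrink)

-- The hypothesis on μ compares it with eigenvalues only, so its lower bound is drawn from an
-- eigenvalue in hand. The value 1 is the Rayleigh quotient of eᵢ + eⱼ for an edge ij. The vectors
-- met during bisection are not made to converge: extracting a limit would take a compactness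
-- argument. They serve only to refute coercivity, since their Rayleigh quotients with respect to
-- top - A tend to 0; elimination then delivers an exact kernel vector. This is why the first
-- alternative of elimination is coercivity, with one constant for all x: positivity at each x ≠ 0
-- separately would not be contradicted by small quotients. Elimination avoids division throughout:
-- Schur complements are scaled by the pivot and a coercivity constant is a pair c, d, so the same
-- argument runs over ℚ and over ℝ.

-- Ordered commutative rings over ℚ

record OrderedAlgebra : Set₁ where
  field
    commutativeRing : CommutativeRing 0ℓ 0ℓ
  open CommutativeRing commutativeRing public hiding (zero)
  field
    ι       : ℚ → Carrier
    ι-+     : ∀ p q → ι (p ℚ.+ q) ≈ ι p + ι q
    ι-*     : ∀ p q → ι (p ℚ.* q) ≈ ι p * ι q
    ι-neg   : ∀ p → ι (ℚ.- p) ≈ - ι p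
    ι-0     : ι 0ℚ ≈ 0#
    ι-1     : ι 1ℚ ≈ 1#
    Pos     : Carrier → Set
    Nonneg  : Carrier → Set
    pos-resp      : ∀ {x y} → x ≈ y → Pos x → Pos y
    nonneg-resp   : ∀ {x y} → x ≈ y → Nonneg x → Nonneg y
    pos-ι         : ∀ {q} → 0ℚ ℚ.< q → Pos (ι q)
    pos⇒nonneg    : ∀ {x} → Pos x → Nonneg x
    pos-+-nonneg  : ∀ {x y} → Pos x → Nonneg y → Pos (x + y)
    nonneg-+      : ∀ {x y} → Nonneg x → Nonneg y → Nonneg (x + y)
    pos-*         : ∀ {x y} → Pos x → Pos y → Pos (x * y)
    pos-*-nonneg  : ∀ {x y} → Pos x → Nonneg y → Nonneg (x * y)
    square-nonneg : ∀ x → Nonneg (x * x)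
    nonneg-antisym : ∀ {x} → Nonneg x → Nonneg (- x) → x ≈ 0#
    pos-asym      : ∀ {x} → Pos x → ¬ Nonneg (- x)
    pos-*-cancel  : ∀ {x y} → Pos x → x * y ≈ 0# → y ≈ 0#
    square-cancel : ∀ {x} → x * x ≈ 0# → x ≈ 0#

-- Quadratic forms over ordered algebras

module QuadraticForms (O : OrderedAlgebra) where
  open OrderedAlgebra O public
  open SemiringSum semiring public
    using (sum; sum-cong-≋; ∑-comm; ∑-distrib-+; *-distribˡ-sum; *-distribʳ-sum)
  open RingProperties ring using (-0#≈0#)
  open import Relation.Binary.Reasoning.Setoid setoid

  private
    ι-homomorphism : CommutativeRing.rawRing ℚ.+-*-commutativeRing
                       -Raw-AlmostCommutative⟶ fromCommutativeRing commutativeRing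
    ι-homomorphism = record
      { ⟦_⟧ = ι ; +-homo = ι-+ ; *-homo = ι-* ; -‿homo = ι-neg ; 0-homo = ι-0 ; 1-homo = ι-1 }

    ι≟ : ∀ p q → Maybe (ι p ≈ ι q)
    ι≟ p q with p ℚ.≟ q
    ... | yes p≡q = just (reflexive (≡.cong ι p≡q))
    ... | no  _   = nothing

  module Solver = RingSolver (CommutativeRing.rawRing ℚ.+-*-commutativeRing)
    (fromCommutativeRing commutativeRing) ι-homomorphism ι≟
  open Solver using (solve; _:=_; _:+_; _:*_; _:-_; :-_; con)

  2ℚ : ℚ
  2ℚ = 1ℚ ℚ.+ 1ℚ

  1-pos : Pos 1#
  1-pos = pos-resp ι-1 (pos-ι (ℚ.positive⁻¹ 1ℚ))

  2-pos : Pos (ι 2ℚ)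
  2-pos = pos-ι (ℚ.positive⁻¹ 2ℚ)

  0-nonneg : Nonneg 0#
  0-nonneg = nonneg-resp (zeroˡ 0#) (square-nonneg 0#)

  neg-nonneg : ∀ {x} → x ≈ 0# → Nonneg (- x)
  neg-nonneg x≈0 = nonneg-resp (trans (sym -0#≈0#) (-‿cong (sym x≈0))) 0-nonneg

  1≉0 : ¬ 1# ≈ 0#
  1≉0 1≈0 = pos-asym 1-pos (neg-nonneg 1≈0)

  sum-linear : ∀ {n} c d (f g : Vector Carrier n) →
    sum (λ i → c * f i + d * g i) ≈ c * sum f + d * sum g
  sum-linear {zero} c d f g = sym (trans (+-cong (zeroʳ c) (zeroʳ d)) (+-identityˡ 0#))
  sum-linear {suc n} c d f g = begin
    c * f zero + d * g zero + sum (λ i → c * f (suc i) + d * g (suc i))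
      ≈⟨ +-congˡ (sum-linear c d (tail f) (tail g)) ⟩
    c * f zero + d * g zero + (c * sum (tail f) + d * sum (tail g))
      ≈⟨ solve 6 (λ c d x y u v → c :* x :+ d :* y :+ (c :* u :+ d :* v)
           := c :* (x :+ u) :+ d :* (y :+ v)) refl c d _ _ _ _ ⟩
    c * sum f + d * sum g ∎

  sum-zero : ∀ {n} {f : Vector Carrier n} → (∀ i → f i ≈ 0#) → sum f ≈ 0#
  sum-zero {zero} h = refl
  sum-zero {suc n} h = trans (+-cong (h zero) (sum-zero λ i → h (suc i))) (+-identityˡ 0#)

  sum-nonneg : ∀ {n} {f : Vector Carrier n} → (∀ i → Nonneg (f i)) → Nonneg (sum f)
  sum-nonneg {zero} h = 0-nonneg
  sum-nonneg {suc n} h = nonneg-+ (h zero) (sum-nonneg λ i → h (suc i))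

  infix 8 _∙_ _·_

  _∙_ : ∀ {n} → Vector Carrier n → Vector Carrier n → Carrier
  x ∙ y = sum (λ i → x i * y i)

  Mat : ℕ → Set
  Mat n = Fin n → Fin n → Carrier

  _·_ : ∀ {n} → Mat n → Vector Carrier n → Vector Carrier n
  (S · x) i = sum (λ j → S i j * x j)

  form : ∀ {n} → Mat n → Vector Carrier n → Carrier
  form S x = x ∙ (S · x)

  Sym : ∀ {n} → Mat n → Set
  Sym S = ∀ i j → S i j ≈ S j i

  form-congʳ : ∀ {n} (S : Mat n) {x y : Vector Carrier n} → (∀ i → x i ≈ y i) → form S x ≈ form S y
  form-congʳ S x≈y = sum-cong-≋ (λ i → *-cong (x≈y i) (sum-cong-≋ (λ j → *-congˡ (x≈y j))))

  norm-nonneg : ∀ {n} (x : Vector Carrier n) → Nonneg (x ∙ x)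
  norm-nonneg x = sum-nonneg (λ i → square-nonneg (x i))

  norm-zero : ∀ {n} (x : Vector Carrier n) → Nonneg (- (x ∙ x)) → ∀ i → x i ≈ 0#
  norm-zero x h zero = square-cancel (nonneg-antisym (square-nonneg (x zero))
    (nonneg-resp (solve 2 (λ u v → :- (u :+ v) :+ v := :- u) refl _ _)
      (nonneg-+ h (norm-nonneg (tail x)))))
  norm-zero x h (suc i) = norm-zero (tail x)
    (nonneg-resp (solve 2 (λ u v → :- (u :+ v) :+ u := :- v) refl _ _)
      (nonneg-+ h (square-nonneg (x zero)))) i

  -- The Kronecker delta, used both as the identity matrix in `shift` and as the standard basis in
  -- `pair`. The recursive form lets sums against it be evaluated by induction.
  δ : ∀ {n} → Fin n → Fin n → Carrier
  δ zero    zero    = 1#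
  δ zero    (suc j) = 0#
  δ (suc i) zero    = 0#
  δ (suc i) (suc j) = δ i j

  sum-δ : ∀ {n} (f : Vector Carrier n) i → sum (λ k → f k * δ i k) ≈ f i
  sum-δ f zero = trans (+-cong (*-identityʳ (f zero)) (sum-zero λ k → zeroʳ (f (suc k))))
    (+-identityʳ (f zero))
  sum-δ f (suc i) = trans (+-cong (zeroʳ (f zero)) (sum-δ (tail f) i)) (+-identityˡ (f (suc i)))

  pair : ∀ {n} → Fin n → Fin n → Carrier → Carrier → Vector Carrier n
  pair i j y t k = y * δ i k + t * δ j k

  sum-pair : ∀ {n} (f : Vector Carrier n) i j y t →
    sum (λ k → f k * pair i j y t k) ≈ y * f i + t * f j
  sum-pair f i j y t = begin
    sum (λ k → f k * pair i j y t k)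
      ≈⟨ sum-cong-≋ (λ k → solve 5 (λ f y d t e → f :* (y :* d :+ t :* e)
           := y :* (f :* d) :+ t :* (f :* e)) refl (f k) y (δ i k) t (δ j k)) ⟩
    sum (λ k → y * (f k * δ i k) + t * (f k * δ j k))
      ≈⟨ sum-linear y t (λ k → f k * δ i k) (λ k → f k * δ j k) ⟩
    y * sum (λ k → f k * δ i k) + t * sum (λ k → f k * δ j k)
      ≈⟨ +-cong (*-congˡ (sum-δ f i)) (*-congˡ (sum-δ f j)) ⟩
    y * f i + t * f j ∎

  form-pair : ∀ {n} (S : Mat n) → Sym S → ∀ i j y t →
    form S (pair i j y t) ≈ y * y * S i i + ι 2ℚ * (y * t * S i j) + t * t * S j j
  form-pair S S-sym i j y t = begin
    form S x
      ≈⟨ sum-cong-≋ (λ k → trans (*-congˡ (sum-pair (S k) i j y t)) (*-comm _ _)) ⟩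
    sum (λ k → (y * S k i + t * S k j) * x k)
      ≈⟨ sum-pair (λ k → y * S k i + t * S k j) i j y t ⟩
    y * (y * S i i + t * S i j) + t * (y * S j i + t * S j j)
      ≈⟨ +-congˡ (*-congˡ (+-congʳ (*-congˡ (S-sym j i)))) ⟩
    y * (y * S i i + t * S i j) + t * (y * S i j + t * S j j)
      ≈⟨ solve 5 (λ y t a b c → y :* (y :* a :+ t :* b) :+ t :* (y :* b :+ t :* c)
           := y :* y :* a :+ con 2ℚ :* (y :* t :* b) :+ t :* t :* c) refl y t _ _ _ ⟩
    y * y * S i i + ι 2ℚ * (y * t * S i j) + t * t * S j j ∎
    where x = pair i j y t

  -- With b ∙ x = βu + z, adding (βu - z)² gives 2β²u² + 2z², and z² ≤ Kp by induction, p being the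
  -- squared norm of the tail. The constant is far from sharp; the summand 1 in 1 + β² makes it
  -- strictly positive, as `schur-coercive` requires.
  functional-bounded : ∀ {n} (b : Vector Carrier n) →
    ∃[ K ] (Pos K × ∀ x → Nonneg (K * (x ∙ x) - (b ∙ x) * (b ∙ x)))
  functional-bounded {zero} b = 1# , 1-pos , λ x →
    nonneg-resp (sym (trans (+-cong (*-identityˡ 0#) (-‿cong (zeroˡ 0#))) (-‿inverseʳ 0#))) 0-nonneg
  functional-bounded {suc n} b =
    let K , K-pos , bound = functional-bounded (tail b)
        β = b zero
        L-pos : Pos (ι 1ℚ + β * β)
        L-pos = pos-+-nonneg (pos-ι (ℚ.positive⁻¹ 1ℚ)) (square-nonneg β)
        L = ι 1ℚ + β * β
    in ι 2ℚ * L + ι 2ℚ * K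
     , pos-+-nonneg (pos-* 2-pos L-pos) (pos⇒nonneg (pos-* 2-pos K-pos))
     , λ x → nonneg-resp
         (solve 5 (λ β K u z p →
            let L = con 1ℚ :+ β :* β in
            (β :* u :- z) :* (β :* u :- z) :+ con 2ℚ :* (K :* p :- z :* z)
              :+ con 2ℚ :* (L :* p) :+ con 2ℚ :* (u :* u) :+ con 2ℚ :* (K :* (u :* u))
            := (con 2ℚ :* L :+ con 2ℚ :* K) :* (u :* u :+ p)
              :- (β :* u :+ z) :* (β :* u :+ z))
            refl β K (x zero) (tail b ∙ tail x) (tail x ∙ tail x))
         (nonneg-+ (nonneg-+ (nonneg-+ (nonneg-+
            (square-nonneg _)
            (pos-*-nonneg 2-pos (bound (tail x))))
            (pos-*-nonneg 2-pos (pos-*-nonneg L-pos (norm-nonneg (tail x)))))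
            (pos-*-nonneg 2-pos (square-nonneg (x zero))))
            (pos-*-nonneg 2-pos (pos-*-nonneg K-pos (square-nonneg (x zero)))))

  -- Coercivity reads S(x) ≥ (c / d) ∣x∣² with the quotient cleared, because elimination never
  -- inverts a pivot.
  Coercive Degenerate Negative : ∀ {n} → Mat n → Set
  Coercive S = ∃[ c ] ∃[ d ] (Pos c × Pos d × ∀ x → Nonneg (d * form S x - c * (x ∙ x)))
  Degenerate S = ∃[ x ] (¬ (∀ i → x i ≈ 0#) × ∀ i → (S · x) i ≈ 0#)
  Negative S = ∃[ x ] Pos (- form S x)

  minor : ∀ {n} → Mat (suc n) → Mat n
  minor S i j = S (suc i) (suc j)

  column : ∀ {n} → Mat (suc n) → Vector Carrier n
  column S i = S (suc i) zero

  form-split : ∀ {n} (S : Mat (suc n)) → Sym S → ∀ x →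
    form S x ≈ S zero zero * (x zero * x zero) + ι 2ℚ * (x zero * (column S ∙ tail x))
            + form (minor S) (tail x)
  form-split S S-sym x = begin
    x₀ * (S zero zero * x₀ + sum (λ j → S zero (suc j) * x (suc j)))
      + sum (λ i → x (suc i) * (column S i * x₀ + (minor S · tail x) i))
      ≈⟨ +-cong
           (*-congˡ (+-congˡ (sum-cong-≋ (λ j → *-congʳ (S-sym zero (suc j))))))
           (trans (sum-cong-≋ (λ i → solve 4 (λ u b x s → u :* (b :* x :+ s)
               := x :* (b :* u) :+ con 1ℚ :* (u :* s)) refl
               (x (suc i)) (column S i) x₀ ((minor S · tail x) i)))
             (sum-linear x₀ (ι 1ℚ) (λ i → column S i * x (suc i))
               (λ i → x (suc i) * (minor S · tail x) i))) ⟩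
    x₀ * (S zero zero * x₀ + z) + (x₀ * z + ι 1ℚ * form (minor S) (tail x))
      ≈⟨ solve 4 (λ x a z q → x :* (a :* x :+ z) :+ (x :* z :+ con 1ℚ :* q)
           := a :* (x :* x) :+ con 2ℚ :* (x :* z) :+ q) refl x₀ _ z _ ⟩
    S zero zero * (x₀ * x₀) + ι 2ℚ * (x₀ * z) + form (minor S) (tail x) ∎
    where
    x₀ = x zero
    z  = column S ∙ tail x

  -- The Schur complement of the top left entry, multiplied by that entry to avoid division.
  schur : ∀ {n} → Mat (suc n) → Mat n
  schur S i j = S zero zero * minor S i j + - column S i * column S j

  schur-sym : ∀ {n} (S : Mat (suc n)) → Sym S → Sym (schur S)
  schur-sym S S-sym i j = +-cong (*-congˡ (S-sym (suc i) (suc j)))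
    (solve 2 (λ u v → :- u :* v := :- v :* u) refl _ _)

  schur-· : ∀ {n} (S : Mat (suc n)) x i →
    (schur S · x) i ≈ S zero zero * (minor S · x) i + - column S i * (column S ∙ x)
  schur-· S x i = trans
    (sum-cong-≋ (λ j → solve 5 (λ a s b c x → (a :* s :+ :- b :* c) :* x
        := a :* (s :* x) :+ :- b :* (c :* x)) refl
        (S zero zero) (minor S i j) (column S i) (column S j) (x j)))
    (sum-linear (S zero zero) (- column S i) (λ j → minor S i j * x j) (λ j → column S j * x j))

  form-schur : ∀ {n} (S : Mat (suc n)) x →
    form (schur S) x ≈ S zero zero * form (minor S) x + - (column S ∙ x) * (column S ∙ x)
  form-schur S x = trans
    (sum-cong-≋ (λ i → trans (*-congˡ (schur-· S x i))
      (solve 5 (λ x a s b z → x :* (a :* s :+ :- b :* z)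
        := a :* (x :* s) :+ :- z :* (b :* x)) refl
        (x i) (S zero zero) ((minor S · x) i) (column S i) (column S ∙ x))))
    (sum-linear (S zero zero) (- (column S ∙ x)) (λ i → x i * (minor S · x) i)
      (λ i → column S i * x i))

  -- Completing the square: a S(x) = (a x₀ + z)² + S″(x′) where S″ is the form of the Schur
  -- complement, a is the pivot and z = b ∙ x′, together with (a x₀)² ≤ 2 (a x₀ + z)² + 2 z².
  schur-coercive : ∀ {n} (S : Mat (suc n)) → Sym S → Pos (S zero zero) →
    Coercive (schur S) → Coercive S
  schur-coercive S S-sym a-pos (c , d , c-pos , d-pos , bound) =
    let K , K-pos , functional = functional-bounded (column S)
        a     = S zero zero
        J     = ι 2ℚ * K + a * a
        J-pos = pos-+-nonneg (pos-* 2-pos K-pos) (square-nonneg a)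
        M     = ι 2ℚ * c + d * J
        M-pos = pos-+-nonneg (pos-* 2-pos c-pos) (pos⇒nonneg (pos-* d-pos J-pos))
        cd-pos = pos-* c-pos d-pos
    in c * d * (a * a) , M * (a * d) , pos-* cd-pos (pos-* a-pos a-pos)
     , pos-* M-pos (pos-* a-pos d-pos)
     , λ x →
        let x₀ = x zero
            z  = column S ∙ tail x
            p  = tail x ∙ tail x
            q  = form (minor S) (tail x)
        in nonneg-resp
          (begin
            M * (d * form (schur S) (tail x) - c * p)
              + d * (d * (J * ((a * x₀ + z) * (a * x₀ + z))))
              + ι 2ℚ * (c * (c * p))
              + c * d * ((a * x₀ + z + z) * (a * x₀ + z + z))
              + ι 2ℚ * (c * d * (K * p - z * z))
              ≈⟨ +-congʳ (+-congʳ (+-congʳ (+-congʳ (*-congˡ (+-congʳ (*-congˡ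
                   (form-schur S (tail x)))))))) ⟩
            M * (d * (a * q + - z * z) - c * p)
              + d * (d * (J * ((a * x₀ + z) * (a * x₀ + z))))
              + ι 2ℚ * (c * (c * p))
              + c * d * ((a * x₀ + z + z) * (a * x₀ + z + z))
              + ι 2ℚ * (c * d * (K * p - z * z))
              ≈⟨ solve 8 (λ a x z q p K c d →
                   let J = con 2ℚ :* K :+ a :* a
                       M = con 2ℚ :* c :+ d :* J
                       y = a :* x :+ z in
                   M :* (d :* (a :* q :+ :- z :* z) :- c :* p)
                     :+ d :* (d :* (J :* (y :* y)))
                     :+ con 2ℚ :* (c :* (c :* p))
                     :+ c :* d :* ((y :+ z) :* (y :+ z))
                     :+ con 2ℚ :* (c :* d :* (K :* p :- z :* z))
                   := M :* (a :* d) :* (a :* (x :* x) :+ con 2ℚ :* (x :* z) :+ q)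
                     :- c :* d :* (a :* a) :* (x :* x :+ p)) refl a x₀ z q p K c d ⟩
            M * (a * d) * (a * (x₀ * x₀) + ι 2ℚ * (x₀ * z) + q)
              - c * d * (a * a) * (x₀ * x₀ + p)
              ≈⟨ +-congʳ (*-congˡ (sym (form-split S S-sym x))) ⟩
            M * (a * d) * form S x - c * d * (a * a) * (x ∙ x) ∎)
          (nonneg-+ (nonneg-+ (nonneg-+ (nonneg-+
            (pos-*-nonneg M-pos (bound (tail x)))
            (pos-*-nonneg d-pos (pos-*-nonneg d-pos (pos-*-nonneg J-pos (square-nonneg _)))))
            (pos-*-nonneg 2-pos (pos-*-nonneg c-pos (pos-*-nonneg c-pos (norm-nonneg (tail x))))))
            (pos-*-nonneg cd-pos (square-nonneg _)))
            (pos-*-nonneg 2-pos (pos-*-nonneg cd-pos (functional (tail x)))))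

  -- With pivot a and z = b ∙ w, the entry -z solves a x₀ + b ∙ x′ = 0 for x′ = a w without
  -- division. On such vectors row zero of S x vanishes, the other rows give the Schur complement
  -- applied to w, and S(x) is a times the value of the Schur complement at w.
  lift : ∀ {n} → Mat (suc n) → Vector Carrier n → Vector Carrier (suc n)
  lift S w zero    = - (column S ∙ w)
  lift S w (suc i) = S zero zero * w i

  sum-scale : ∀ {n} a (f w : Vector Carrier n) → sum (λ i → f i * (a * w i)) ≈ a * sum (λ i → f i * w i)
  sum-scale {zero} a f w = sym (zeroʳ a)
  sum-scale {suc n} a f w = trans (+-congˡ (sum-scale a (tail f) (tail w)))
    (solve 4 (λ f a w s → f :* (a :* w) :+ a :* s := a :* (f :* w :+ s)) refl _ a _ _)

  schur-degenerate : ∀ {n} (S : Mat (suc n)) → Sym S → Pos (S zero zero) →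
    Degenerate (schur S) → Degenerate S
  schur-degenerate S S-sym a-pos (w , w≉0 , Sw≈0) = lift S w
    , (λ h → w≉0 (λ i → pos-*-cancel a-pos (h (suc i))))
    , λ where
        zero → trans (+-congˡ (trans (sum-scale _ (λ j → S zero (suc j)) w)
            (*-congˡ (sum-cong-≋ (λ j → *-congʳ (S-sym zero (suc j)))))))
          (trans (solve 2 (λ a z → a :* (:- z) :+ a :* z := con 0ℚ) refl _ _) ι-0)
        (suc i) → trans (+-congˡ (sum-scale _ (minor S i) w))
          (trans (solve 4 (λ b z a s → b :* (:- z) :+ a :* s := a :* s :+ :- b :* z) refl _ _ _ _)
            (trans (sym (schur-· S w i)) (Sw≈0 i)))

  schur-negative : ∀ {n} (S : Mat (suc n)) → Sym S → Pos (S zero zero) →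
    Negative (schur S) → Negative S
  schur-negative S S-sym a-pos (w , neg) = lift S w , pos-resp
    (begin
      a * - form (schur S) w
        ≈⟨ *-congˡ (-‿cong (form-schur S w)) ⟩
      a * - (a * form (minor S) w + - z * z)
        ≈⟨ solve 3 (λ a q z → a :* (:- (a :* q :+ :- z :* z))
             := :- (a :* (:- z :* :- z) :+ con 2ℚ :* (:- z :* (a :* z)) :+ a :* (a :* q)))
             refl a (form (minor S) w) z ⟩
      - (a * (- z * - z) + ι 2ℚ * (- z * (a * z)) + a * (a * form (minor S) w))
        ≈⟨ -‿cong (+-cong (+-congˡ (*-congˡ (*-congˡ (sym (sum-scale a (column S) w)))))
             (sym form-scaled)) ⟩
      - (a * (- z * - z) + ι 2ℚ * (- z * (column S ∙ tail (lift S w)))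
          + form (minor S) (tail (lift S w)))
        ≈⟨ -‿cong (sym (form-split S S-sym (lift S w))) ⟩
      - form S (lift S w) ∎)
    (pos-* a-pos neg)
    where
    a = S zero zero
    z = column S ∙ w
    form-scaled : form (minor S) (λ i → a * w i) ≈ a * (a * form (minor S) w)
    form-scaled = trans
      (sum-cong-≋ (λ i → trans (*-congˡ (sum-scale a (minor S i) w))
        (solve 3 (λ a w s → a :* w :* (a :* s) := w :* (a :* (a :* s))) refl a _ _)))
      (trans (sum-scale a w (λ i → a * (minor S · w) i)) (*-congˡ (sum-scale a w (minor S · w))))

  zero-column-degenerate : ∀ {n} (S : Mat (suc n)) → S zero zero ≈ 0# →
    (∀ i → column S i ≈ 0#) → Degenerate S
  zero-column-degenerate S a≈0 b≈0 = δ zero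
    , (λ h → 1≉0 (h zero))
    , λ i → trans (sum-δ (S i) zero) (column≈0 i)
    where
    column≈0 : ∀ i → S i zero ≈ 0#
    column≈0 zero    = a≈0
    column≈0 (suc i) = b≈0 i

  negative-pivot : ∀ {n} (S : Mat (suc n)) → Sym S → Pos (- S zero zero) → Negative S
  negative-pivot S S-sym neg = pair zero zero (ι 1ℚ) (ι 0ℚ) , pos-resp
    (-‿cong (trans (solve 1 (λ a → a := con 1ℚ :* con 1ℚ :* a :+ con 2ℚ :* (con 1ℚ :* con 0ℚ :* a)
       :+ con 0ℚ :* con 0ℚ :* a) refl _) (sym (form-pair S S-sym zero zero (ι 1ℚ) (ι 0ℚ)))))
    neg

  -- At a vector with entries y and t in two places, a zero pivot leaves 2ytb + t²s. The choice t =
  -- 2b, y = -(s + 1) cancels the part with s and leaves -4b². Assuming b² positive leaves the sign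
  -- of b open.
  null-pivot-negative : ∀ {n} (S : Mat (suc n)) → Sym S → S zero zero ≈ 0# →
    ∀ i → Pos (column S i * column S i) → Negative S
  null-pivot-negative S S-sym a≈0 i b²-pos = pair zero (suc i) y t , pos-resp
    (begin
      ι 2ℚ * (ι 2ℚ * (b * b))
        ≈⟨ solve 2 (λ b s → con 2ℚ :* (con 2ℚ :* (b :* b))
             := let y = :- (s :+ con 1ℚ) ; t = con 2ℚ :* b in
                :- (y :* y :* con 0ℚ :+ con 2ℚ :* (y :* t :* b) :+ t :* t :* s)) refl b s ⟩
      - (y * y * ι 0ℚ + ι 2ℚ * (y * t * b) + t * t * s)
        ≈⟨ -‿cong (+-congʳ (+-cong (*-congˡ (trans ι-0 (sym a≈0)))
             (*-congˡ (*-congˡ (S-sym (suc i) zero))))) ⟩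
      - (y * y * S zero zero + ι 2ℚ * (y * t * S zero (suc i)) + t * t * s)
        ≈⟨ -‿cong (sym (form-pair S S-sym zero (suc i) y t)) ⟩
      - form S (pair zero (suc i) y t) ∎)
    (pos-* 2-pos (pos-* 2-pos b²-pos))
    where
    b = column S i
    s = S (suc i) (suc i)
    y = - (s + ι 1ℚ)
    t = ι 2ℚ * b

  -- The modality M is the identity over ℚ and double negation over ℝ, where signs are undecidable.
  module Classification
    (M : Set → Set) (return : ∀ {A : Set} → A → M A)
    (_>>=_ : ∀ {A B : Set} → M A → (A → M B) → M B)
    (sign : ∀ x → M (Pos x ⊎ x ≈ 0# ⊎ Pos (- x)))
    where

    all-zero-or-not : ∀ {n} (b : Vector Carrier n) →
      M ((∀ i → b i ≈ 0#) ⊎ ∃[ i ] Pos (b i * b i))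
    all-zero-or-not {zero} b = return (inj₁ λ ())
    all-zero-or-not {suc n} b = sign (b zero) >>= λ where
      (inj₁ pos) → return (inj₂ (zero , pos-* pos pos))
      (inj₂ (inj₂ neg)) → return (inj₂ (zero ,
        pos-resp (solve 1 (λ b → :- b :* :- b := b :* b) refl (b zero)) (pos-* neg neg)))
      (inj₂ (inj₁ b₀≈0)) → all-zero-or-not (tail b) >>= λ where
        (inj₁ b≈0) → return (inj₁ λ where
          zero    → b₀≈0
          (suc i) → b≈0 i)
        (inj₂ (i , pos)) → return (inj₂ (suc i , pos))

    -- Only a positive pivot leads to recursion. A zero or negative pivot is settled at once by a
    -- vector with at most two nonzero coordinates.
    classify : ∀ {n} (S : Mat n) → Sym S → M (Coercive S ⊎ Degenerate S ⊎ Negative S)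
    classify {zero} S S-sym = return (inj₁ (1# , 1# , 1-pos , 1-pos ,
      λ x → nonneg-resp (sym (-‿inverseʳ (1# * 0#))) 0-nonneg))
    classify {suc n} S S-sym = sign (S zero zero) >>= λ where
      (inj₁ pos) → classify (schur S) (schur-sym S S-sym) >>= λ where
        (inj₁ coercive) → return (inj₁ (schur-coercive S S-sym pos coercive))
        (inj₂ (inj₁ degenerate)) → return (inj₂ (inj₁ (schur-degenerate S S-sym pos degenerate)))
        (inj₂ (inj₂ negative)) → return (inj₂ (inj₂ (schur-negative S S-sym pos negative)))
      (inj₂ (inj₂ neg)) → return (inj₂ (inj₂ (negative-pivot S S-sym neg)))
      (inj₂ (inj₁ a≈0)) → all-zero-or-not (column S) >>= λ where
        (inj₁ b≈0) → return (inj₂ (inj₁ (zero-column-degenerate S a≈0 b≈0)))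
        (inj₂ (i , pos)) → return (inj₂ (inj₂ (null-pivot-negative S S-sym a≈0 i pos)))

-- Natural numbers in ℚ

natℚ : ℕ → ℚ
natℚ k = + k ℚ./ 1

-- Rational fractions are normalised by a gcd that does not compute for variable k and l, so the
-- identity is checked on unnormalised fractions, where it is a cross multiplication.
natℚ-+ : ∀ k l → natℚ (k ℕ.+ l) ≡ natℚ k ℚ.+ natℚ l
natℚ-+ k l = ℚ.toℚᵘ-injective (begin
  ℚ.toℚᵘ (natℚ (k ℕ.+ l))               ≈⟨ ℚ.toℚᵘ-fromℚᵘ (ℚᵘ.mkℚᵘ (+ (k ℕ.+ l)) 0) ⟩
  ℚᵘ.mkℚᵘ (+ (k ℕ.+ l)) 0               ≈⟨ ℚᵘ.*≡* (≡.cong (ℤ._* + 1) (≡.cong₂ ℤ._+_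
      (≡.sym (ℤ.*-identityʳ (+ k))) (≡.sym (ℤ.*-identityʳ (+ l))))) ⟩
  ℚᵘ.mkℚᵘ (+ k) 0 ℚᵘ.+ ℚᵘ.mkℚᵘ (+ l) 0  ≈⟨ ℚᵘ.+-cong
      (ℚᵘ.≃-sym (ℚ.toℚᵘ-fromℚᵘ (ℚᵘ.mkℚᵘ (+ k) 0))) (ℚᵘ.≃-sym (ℚ.toℚᵘ-fromℚᵘ (ℚᵘ.mkℚᵘ (+ l) 0))) ⟩
  ℚ.toℚᵘ (natℚ k) ℚᵘ.+ ℚ.toℚᵘ (natℚ l)  ≈⟨ ℚᵘ.≃-sym (ℚ.toℚᵘ-homo-+ (natℚ k) (natℚ l)) ⟩
  ℚ.toℚᵘ (natℚ k ℚ.+ natℚ l) ∎)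
  where
  open ℚᵘ.≃-Reasoning
  import Data.Integer.Properties as ℤ

natℚ-* : ∀ k l → natℚ (k ℕ.* l) ≡ natℚ k ℚ.* natℚ l
natℚ-* zero    l = ≡.sym (ℚ.*-zeroˡ (natℚ l))
natℚ-* (suc k) l = ≡.trans (natℚ-+ l (k ℕ.* l)) (≡.trans
  (≡.cong₂ ℚ._+_ (≡.sym (ℚ.*-identityˡ (natℚ l))) (natℚ-* k l))
  (≡.trans (≡.sym (ℚ.*-distribʳ-+ (natℚ l) 1ℚ (natℚ k)))
    (≡.cong (ℚ._* natℚ l) (≡.sym (natℚ-+ 1 k)))))

natℚ-nonneg : ∀ k → 0ℚ ℚ.≤ natℚ k
natℚ-nonneg k = ℚ.nonNegative⁻¹ (natℚ k) {{ℚ.normalize-nonNeg k 1}}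

natℚ-mono : ∀ {k l} → k ℕ.≤ l → natℚ k ℚ.≤ natℚ l
natℚ-mono {k} {l} k≤l = begin
  natℚ k                    ≡⟨ ≡.sym (ℚ.+-identityʳ (natℚ k)) ⟩
  natℚ k ℚ.+ 0ℚ             ≤⟨ ℚ.+-monoʳ-≤ (natℚ k) (natℚ-nonneg (l ℕ.∸ k)) ⟩
  natℚ k ℚ.+ natℚ (l ℕ.∸ k) ≡⟨ ≡.sym (natℚ-+ k (l ℕ.∸ k)) ⟩
  natℚ (k ℕ.+ (l ℕ.∸ k))    ≡⟨ ≡.cong natℚ (ℕ.m+[n∸m]≡n k≤l) ⟩
  natℚ l ∎
  where open ℚ.≤-Reasoning

-- Spectral bounds for 0-1 matrices

module ZeroOneMatrices (O : OrderedAlgebra) where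
  open QuadraticForms O public
  open Solver using (solve; _:=_; _:+_; _:*_; _:-_; :-_; con)
  open import Relation.Binary.Reasoning.Setoid setoid

  -- Weights of this kind can be treated by cases even where the order is undecidable.
  Bit : Carrier → Set
  Bit r = r ≈ 0# ⊎ r ≈ 1#

  bit-*-nonneg : ∀ {r x} → Bit r → Nonneg x → Nonneg (r * x)
  bit-*-nonneg (inj₁ r≈0) h = nonneg-resp (sym (trans (*-congʳ r≈0) (zeroˡ _))) 0-nonneg
  bit-*-nonneg (inj₂ r≈1) h = nonneg-resp (sym (trans (*-congʳ r≈1) (*-identityˡ _))) h

  bit-complement-nonneg : ∀ {r} x → Bit r → Nonneg (x * x - r * (x * x))
  bit-complement-nonneg x (inj₁ r≈0) =
    nonneg-resp (trans (solve 1 (λ x → x := x :- con 0ℚ :* x) refl _)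
      (+-congˡ (-‿cong (*-congʳ (trans ι-0 (sym r≈0)))))) (square-nonneg x)
  bit-complement-nonneg x (inj₂ r≈1) =
    nonneg-resp (trans (trans (sym ι-0) (solve 1 (λ x → con 0ℚ := x :- con 1ℚ :* x) refl _))
      (+-congˡ (-‿cong (*-congʳ (trans ι-1 (sym r≈1)))))) 0-nonneg

  private
    w² : ∀ {n} → Vector Carrier n → Vector Carrier n → Carrier
    w² r v = sum (λ j → r j * (v j * v j))

  -- ∑ⱼ rⱼ (u − vⱼ)², expanded.
  weighted-deviation-nonneg : ∀ {n} (r v : Vector Carrier n) → (∀ j → Bit (r j)) → ∀ u →
    Nonneg (sum r * (u * u) + w² r v - ι 2ℚ * (u * (r ∙ v)))
  weighted-deviation-nonneg {zero} r v bit u = nonneg-resp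
    (trans (sym ι-0) (trans (solve 1 (λ u → con 0ℚ := con 0ℚ :* (u :* u) :+ con 0ℚ
      :- con 2ℚ :* (u :* con 0ℚ)) refl u)
      (+-cong (+-cong (*-congʳ ι-0) ι-0) (-‿cong (*-congˡ (*-congˡ ι-0)))))) 0-nonneg
  weighted-deviation-nonneg {suc n} r v bit u = nonneg-resp
    (solve 6 (λ r v R P s u → r :* ((u :- v) :* (u :- v)) :+ (R :* (u :* u) :+ P :- con 2ℚ :* (u :* s))
      := (r :+ R) :* (u :* u) :+ (r :* (v :* v) :+ P) :- con 2ℚ :* (u :* (r :* v :+ s)))
      refl (r zero) (v zero) (sum (tail r)) (w² (tail r) (tail v)) (tail r ∙ tail v) u)
    (nonneg-+ (bit-*-nonneg (bit zero) (square-nonneg (u - v zero)))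
      (weighted-deviation-nonneg (tail r) (tail v) (bit ∘ suc) u))

  -- Lagrange's identity, built up one coordinate at a time: a new coordinate adds r₀ ∑ rⱼ (v₀ -
  -- vⱼ)² to the difference.
  cauchy-schwarz : ∀ {n} (r v : Vector Carrier n) → (∀ j → Bit (r j)) →
    Nonneg (sum r * w² r v - (r ∙ v) * (r ∙ v))
  cauchy-schwarz {zero} r v bit = nonneg-resp
    (trans (sym (-‿inverseʳ (0# * 0#))) refl) 0-nonneg
  cauchy-schwarz {suc n} r v bit = nonneg-resp
    (solve 5 (λ r v R P s → r :* (R :* (v :* v) :+ P :- con 2ℚ :* (v :* s)) :+ (R :* P :- s :* s)
      := (r :+ R) :* (r :* (v :* v) :+ P) :- (r :* v :+ s) :* (r :* v :+ s))
      refl (r zero) (v zero) (sum (tail r)) (w² (tail r) (tail v)) (tail r ∙ tail v))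
    (nonneg-+ (bit-*-nonneg (bit zero)
        (weighted-deviation-nonneg (tail r) (tail v) (bit ∘ suc) (v zero)))
      (cauchy-schwarz (tail r) (tail v) (bit ∘ suc)))

  omitted-mass-nonneg : ∀ {n} (r v : Vector Carrier n) → (∀ j → Bit (r j)) →
    Nonneg (v ∙ v - w² r v)
  omitted-mass-nonneg {zero} r v bit = nonneg-resp (sym (-‿inverseʳ 0#)) 0-nonneg
  omitted-mass-nonneg {suc n} r v bit = nonneg-resp
    (solve 4 (λ x y N P → (x :- y) :+ (N :- P) := (x :+ N) :- (y :+ P)) refl _ _ _ _)
    (nonneg-+ (bit-complement-nonneg (v zero) (bit zero))
      (omitted-mass-nonneg (tail r) (tail v) (bit ∘ suc)))

  -- The square vᵢ² is among those that r omits. For row i of an adjacency matrix this is where the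
  -- absence of loops enters, and it produces the term -∑ dᵢ vᵢ².
  omitted-entry-nonneg : ∀ {n} (r v : Vector Carrier n) → (∀ j → Bit (r j)) →
    ∀ i → r i ≈ 0# → Nonneg (v ∙ v - w² r v - v i * v i)
  omitted-entry-nonneg r v bit zero r≈0 = nonneg-resp
    (trans (solve 3 (λ x N P → N :- P := (x :+ N) :- (con 0ℚ :* x :+ P) :- x) refl
        (v zero * v zero) _ _)
      (+-congʳ (+-congˡ (-‿cong (+-congʳ (*-congʳ (trans ι-0 (sym r≈0))))))))
    (omitted-mass-nonneg (tail r) (tail v) (bit ∘ suc))
  omitted-entry-nonneg r v bit (suc i) r≈0 = nonneg-resp
    (solve 5 (λ x y N P z → (x :- y) :+ (N :- P :- z) := (x :+ N) :- (y :+ P) :- z) refl _ _ _ _ _)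
    (nonneg-+ (bit-complement-nonneg (v zero) (bit zero))
      (omitted-entry-nonneg (tail r) (tail v) (bit ∘ suc) i r≈0))

  bit-sum-*-nonneg : ∀ {n} (r : Vector Carrier n) → (∀ j → Bit (r j)) →
    ∀ {x} → Nonneg x → Nonneg (sum r * x)
  bit-sum-*-nonneg {zero} r bit h = nonneg-resp (sym (zeroˡ _)) 0-nonneg
  bit-sum-*-nonneg {suc n} r bit h = nonneg-resp (sym (distribʳ _ _ _))
    (nonneg-+ (bit-*-nonneg (bit zero) h) (bit-sum-*-nonneg (tail r) (bit ∘ suc) h))

  row-bound : ∀ {n} (r v : Vector Carrier n) → (∀ j → Bit (r j)) → ∀ i → r i ≈ 0# →
    Nonneg (sum r * (v ∙ v) - sum r * (v i * v i) - (r ∙ v) * (r ∙ v))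
  row-bound r v bit i r≈0 = nonneg-resp
    (solve 5 (λ R N P x s → R :* (N :- P :- x) :+ (R :* P :- s) := R :* N :- R :* x :- s)
      refl (sum r) (v ∙ v) (w² r v) (v i * v i) ((r ∙ v) * (r ∙ v)))
    (nonneg-+ (bit-sum-*-nonneg r bit (omitted-entry-nonneg r v bit i r≈0))
      (cauchy-schwarz r v bit))

  sum-- : ∀ {n} (f g : Vector Carrier n) → sum (λ i → f i - g i) ≈ sum f - sum g
  sum-- f g = trans
    (sum-cong-≋ (λ i → solve 2 (λ x y → x :- y := con 1ℚ :* x :+ (:- con 1ℚ) :* y) refl (f i) (g i)))
    (trans (sum-linear (ι 1ℚ) (- ι 1ℚ) f g)
      (solve 2 (λ x y → con 1ℚ :* x :+ (:- con 1ℚ) :* y := x :- y) refl (sum f) (sum g)))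

  sum-*ʳ : ∀ {n} (f : Vector Carrier n) x → sum (λ i → f i * x) ≈ sum f * x
  sum-*ʳ f x = sym (*-distribʳ-sum x f)

  degree : ∀ {n} → Mat n → Vector Carrier n
  degree A i = sum (A i)

  total : ∀ {n} → Mat n → Carrier
  total A = sum (degree A)

  module _ {n} (A : Mat n) (A-sym : Sym A) (A-bit : ∀ i j → Bit (A i j))
           (A-irrefl : ∀ i → A i i ≈ 0#) where

    -- The sum of the row bounds and the positivity of the Laplacian, before any eigenvalue is
    -- substituted. Everything is doubled because ∑ aᵢⱼ (vᵢ - vⱼ)² runs over ordered pairs and so
    -- meets each edge twice.
    total-bound : ∀ v →
      Nonneg (ι 2ℚ * (total A * (v ∙ v)) - ι 2ℚ * ((A · v) ∙ (A · v)) - ι 2ℚ * form A v)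
    total-bound v = nonneg-resp
      (solve 4 (λ t D a q → con 2ℚ :* (t :- D :- a) :+ (D :+ D :- con 2ℚ :* q)
         := con 2ℚ :* t :- con 2ℚ :* a :- con 2ℚ :* q) refl
         (total A * (v ∙ v)) Dv² ((A · v) ∙ (A · v)) (form A v))
      (nonneg-+ (pos-*-nonneg 2-pos rows) laplacian)
      where
      Dv² : Carrier
      Dv² = w² (degree A) v
      rows : Nonneg (total A * (v ∙ v) - Dv² - (A · v) ∙ (A · v))
      rows = nonneg-resp
        (trans (sum-- (λ i → degree A i * (v ∙ v) - degree A i * (v i * v i)) (λ i → (A · v) i * (A · v) i))
          (+-congʳ (trans (sum-- (λ i → degree A i * (v ∙ v)) (λ i → degree A i * (v i * v i)))
            (+-congʳ (sum-*ʳ (degree A) (v ∙ v))))))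
        (sum-nonneg (λ i → row-bound (A i) v (A-bit i) i (A-irrefl i)))
      neighbours : sum (λ i → w² (A i) v) ≈ Dv²
      neighbours = begin
        sum (λ i → sum (λ j → A i j * (v j * v j)))
          ≈⟨ ∑-comm (λ i j → A i j * (v j * v j)) ⟩
        sum (λ j → sum (λ i → A i j * (v j * v j)))
          ≈⟨ sum-cong-≋ (λ j → trans (sum-*ʳ (λ i → A i j) (v j * v j))
               (*-congʳ (sum-cong-≋ (λ i → A-sym i j)))) ⟩
        Dv² ∎
      laplacian : Nonneg (Dv² + Dv² - ι 2ℚ * form A v)
      laplacian = nonneg-resp
        (trans (sum-- (λ i → degree A i * (v i * v i) + w² (A i) v) (λ i → ι 2ℚ * (v i * (A · v) i)))
          (+-cong
            (trans (∑-distrib-+ (λ i → degree A i * (v i * v i)) (λ i → w² (A i) v))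
              (+-congˡ neighbours))
            (-‿cong (sym (*-distribˡ-sum (ι 2ℚ) (λ i → v i * (A · v) i))))))
        (sum-nonneg (λ i → weighted-deviation-nonneg (A i) v (A-bit i) (v i)))

    -- Dropping ∣Av∣² from `total-bound` bounds all Rayleigh quotients by the entry sum, which
    -- yields a right end for the bisection.
    rayleigh-bound : ∀ v → Nonneg (ι 2ℚ * (total A * (v ∙ v) - form A v))
    rayleigh-bound v = nonneg-resp
      (solve 3 (λ t a q → (con 2ℚ :* t :- con 2ℚ :* a :- con 2ℚ :* q) :+ con 2ℚ :* a
        := con 2ℚ :* (t :- q)) refl (total A * (v ∙ v)) ((A · v) ∙ (A · v)) (form A v))
      (nonneg-+ (total-bound v) (pos-*-nonneg 2-pos (norm-nonneg (A · v))))

    -- Substituting Av = ev v into `total-bound` makes the gap times ∣v∣² nonpositive, while a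
    -- positive gap makes it nonnegative. So ∣v∣² vanishes, and v with it.
    eigenvalue-bound : ∀ ev v → ¬ (∀ i → v i ≈ 0#) → (∀ i → (A · v) i ≈ ev * v i) →
      ¬ Pos (ev * ev + ev - total A)
    eigenvalue-bound ev v v≉0 Av≈ pos = v≉0 (norm-zero v (neg-nonneg norm≈0))
      where
      N = v ∙ v
      gap = ev * ev + ev - total A
      QA : form A v ≈ ev * N
      QA = trans (sum-cong-≋ (λ i → trans (*-congˡ (Av≈ i))
          (solve 2 (λ x e → x :* (e :* x) := e :* (x :* x)) refl (v i) ev)))
        (sym (*-distribˡ-sum ev (λ i → v i * v i)))
      AA : (A · v) ∙ (A · v) ≈ ev * ev * N
      AA = trans (sum-cong-≋ (λ i → trans (*-cong (Av≈ i) (Av≈ i))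
          (solve 2 (λ x e → e :* x :* (e :* x) := e :* e :* (x :* x)) refl (v i) ev)))
        (sym (*-distribˡ-sum (ev * ev) (λ i → v i * v i)))
      gapN≈0 : ι 2ℚ * (gap * N) ≈ 0#
      gapN≈0 = nonneg-antisym (pos-*-nonneg 2-pos (pos-*-nonneg pos (norm-nonneg v)))
        (nonneg-resp (trans (+-cong (+-congˡ (-‿cong (*-congˡ AA))) (-‿cong (*-congˡ QA)))
          (solve 3 (λ e t N → con 2ℚ :* (t :* N) :- con 2ℚ :* (e :* e :* N) :- con 2ℚ :* (e :* N)
            := :- (con 2ℚ :* ((e :* e :+ e :- t) :* N))) refl ev (total A) N))
          (total-bound v))
      norm≈0 : N ≈ 0#
      norm≈0 = pos-*-cancel pos (pos-*-cancel 2-pos gapN≈0)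

  shift : ∀ {n} → Carrier → Mat n → Mat n
  shift t A i j = t * δ i j - A i j

  δ-sym : ∀ {n} (i j : Fin n) → δ i j ≈ δ j i
  δ-sym zero    zero    = refl
  δ-sym zero    (suc j) = refl
  δ-sym (suc i) zero    = refl
  δ-sym (suc i) (suc j) = δ-sym i j

  shift-sym : ∀ {n} t (A : Mat n) → Sym A → Sym (shift t A)
  shift-sym t A A-sym i j = +-cong (*-congˡ (δ-sym i j)) (-‿cong (A-sym i j))

  shift-· : ∀ {n} t (A : Mat n) x i → (shift t A · x) i ≈ t * x i - (A · x) i
  shift-· t A x i = trans
    (sum-cong-≋ (λ j → solve 4 (λ t d a x → (t :* d :- a) :* x := t :* (x :* d) :- a :* x)
      refl t (δ i j) (A i j) (x j)))
    (trans (sum-- (λ j → t * (x j * δ i j)) (λ j → A i j * x j))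
      (+-congʳ (trans (sym (*-distribˡ-sum t (λ j → x j * δ i j))) (*-congˡ (sum-δ x i)))))

  form-shift : ∀ {n} t (A : Mat n) x → form (shift t A) x ≈ t * (x ∙ x) - form A x
  form-shift t A x = trans
    (sum-cong-≋ (λ i → trans (*-congˡ (shift-· t A x i))
      (solve 3 (λ x t s → x :* (t :* x :- s) := t :* (x :* x) :- x :* s) refl (x i) t ((A · x) i))))
    (trans (sum-- (λ i → t * (x i * x i)) (λ i → x i * (A · x) i))
      (+-congʳ (sym (*-distribˡ-sum t (λ i → x i * x i)))))

  δ-diagonal : ∀ {n} (i : Fin n) → δ i i ≈ 1#
  δ-diagonal zero    = refl
  δ-diagonal (suc i) = δ-diagonal i

  δ-off-diagonal : ∀ {n} {i j : Fin n} → i ≢ j → δ i j ≈ 0#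
  δ-off-diagonal {i = zero}  {zero}  i≢j = contradiction ≡.refl i≢j
  δ-off-diagonal {i = zero}  {suc j} i≢j = refl
  δ-off-diagonal {i = suc i} {zero}  i≢j = refl
  δ-off-diagonal {i = suc i} {suc j} i≢j = δ-off-diagonal (i≢j ∘ ≡.cong suc)

  -- Counting edges by indicators

  indicator : ∀ {P : Set} → Dec P → Carrier
  indicator P? = if ⌊ P? ⌋ then 1# else 0#

  indicator-yes : ∀ {P : Set} (P? : Dec P) → P → indicator P? ≡ 1#
  indicator-yes (yes _) p = ≡.refl
  indicator-yes (no ¬p) p = contradiction p ¬p

  indicator-no : ∀ {P : Set} (P? : Dec P) → ¬ P → indicator P? ≡ 0#
  indicator-no (yes p) ¬p = contradiction p ¬p
  indicator-no (no _)  ¬p = ≡.refl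

  indicator-bit : ∀ {P : Set} (P? : Dec P) → Bit (indicator P?)
  indicator-bit (yes _) = inj₂ refl
  indicator-bit (no _)  = inj₁ refl

  ιℕ : ℕ → Carrier
  ιℕ k = ι (natℚ k)

  ιℕ-+ : ∀ k l → ιℕ (k ℕ.+ l) ≈ ιℕ k + ιℕ l
  ιℕ-+ k l = trans (reflexive (≡.cong ι (natℚ-+ k l))) (ι-+ (natℚ k) (natℚ l))

  module _ {B : Set} {P : Pred B 0ℓ} (P? : Decidable P) where

    count-tabulate : ∀ {n} (g : Fin n → B) →
      ιℕ (length (filter P? (tabulate g))) ≈ sum (λ i → indicator (P? (g i)))
    count-tabulate {zero} g = ι-0
    count-tabulate {suc n} g with P? (g zero)
    ... | yes _ = trans (ιℕ-+ 1 (length (filter P? (tabulate (g ∘ suc)))))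
                    (+-cong ι-1 (count-tabulate (g ∘ suc)))
    ... | no  _ = trans (count-tabulate (g ∘ suc)) (sym (+-identityˡ _))

    count-++ : ∀ xs ys →
      ιℕ (length (filter P? (xs ++ ys))) ≈ ιℕ (length (filter P? xs)) + ιℕ (length (filter P? ys))
    count-++ xs ys = trans
      (reflexive (≡.cong ιℕ (≡.trans (≡.cong length (List.filter-++ P? xs ys))
        (List.length-++ (filter P? xs)))))
      (ιℕ-+ (length (filter P? xs)) (length (filter P? ys)))

  -- A general `g` in place of the identity carries the induction, since the tail of `allFin` is a
  -- tabulation of `suc`. With `g` the identity this expresses the number of edges as a double sum.
  count-product : ∀ {m k n} {P : Pred (Fin m × Fin k) 0ℓ} (P? : Decidable P) (g : Fin n → Fin m) →
    ιℕ (length (filter P? (cartesianProduct (tabulate g) (allFin k))))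
      ≈ sum (λ i → sum (λ j → indicator (P? (g i , j))))
  count-product {n = zero} P? g = ι-0
  count-product {k = k} {n = suc n} P? g = trans
    (count-++ P? (List.map (g zero ,_) (allFin k)) (cartesianProduct (tabulate (g ∘ suc)) (allFin k)))
    (+-cong
      (trans (reflexive (≡.cong (ιℕ ∘ length ∘ filter P?) (List.map-tabulate id (g zero ,_))))
        (count-tabulate P? (g zero ,_)))
      (count-product P? (g ∘ suc)))

  module Adjacency {n} (G : SimpleGraph n) where
    open SimpleGraph G

    A : Mat n
    A i j = indicator (adj? i j)

    A-sym : Sym A
    A-sym i j with adj? i j
    ... | yes a = reflexive (≡.sym (indicator-yes (adj? j i) (symm a)))
    ... | no ¬a = reflexive (≡.sym (indicator-no (adj? j i) (¬a ∘ symm)))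

    A-bit : ∀ i j → Bit (A i j)
    A-bit i j = indicator-bit (adj? i j)

    A-irrefl : ∀ i → A i i ≈ 0#
    A-irrefl i = reflexive (indicator-no (adj? i i) (irrefl i))

    upper? : ∀ i j → Dec (i Fin.< j × Adj i j)
    upper? i j = (i Fin.<? j) ×-dec adj? i j

    indicator-split : ∀ i j (a? : Dec (Adj i j)) →
      indicator a? ≈ indicator (upper? i j) + indicator (upper? j i)
    indicator-split i j (no ¬a) = sym (trans (+-cong
      (reflexive (indicator-no (upper? i j) (¬a ∘ proj₂)))
      (reflexive (indicator-no (upper? j i) (¬a ∘ symm ∘ proj₂)))) (+-identityˡ 0#))
    indicator-split i j (yes a) with Fin.<-cmp i j
    ... | tri< i<j _ j≮i = sym (trans (+-cong
      (reflexive (indicator-yes (upper? i j) (i<j , a)))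
      (reflexive (indicator-no (upper? j i) (j≮i ∘ proj₁)))) (+-identityʳ 1#))
    ... | tri≈ _ ≡.refl _ = contradiction a (irrefl i)
    ... | tri> i≮j _ j<i = sym (trans (+-cong
      (reflexive (indicator-no (upper? i j) (i≮j ∘ proj₁)))
      (reflexive (indicator-yes (upper? j i) (j<i , symm a)))) (+-identityˡ 1#))

    total≈2m : total A ≈ ιℕ (2 ℕ.* numEdges G)
    total≈2m = begin
      sum (λ i → sum (λ j → A i j))
        ≈⟨ sum-cong-≋ (λ i → trans (sum-cong-≋ (λ j → indicator-split i j (adj? i j)))
             (∑-distrib-+ (U i) (λ j → U j i))) ⟩
      sum (λ i → sum (U i) + sum (λ j → U j i))
        ≈⟨ ∑-distrib-+ (λ i → sum (U i)) (λ i → sum (λ j → U j i)) ⟩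
      sum (λ i → sum (U i)) + sum (λ i → sum (λ j → U j i))
        ≈⟨ +-congˡ (∑-comm (λ i j → U j i)) ⟩
      sum (λ i → sum (U i)) + sum (λ i → sum (U i))
        ≈⟨ +-cong (sym upper) (sym upper) ⟩
      ιℕ (numEdges G) + ιℕ (numEdges G)
        ≈⟨ sym (ιℕ-+ (numEdges G) (numEdges G)) ⟩
      ιℕ (numEdges G ℕ.+ numEdges G)
        ≈⟨ reflexive (≡.cong (λ k → ιℕ (numEdges G ℕ.+ k)) (≡.sym (ℕ.+-identityʳ (numEdges G)))) ⟩
      ιℕ (2 ℕ.* numEdges G) ∎
      where
      U : Mat n
      U i j = indicator (upper? i j)
      upper : ιℕ (numEdges G) ≈ sum (λ i → sum (U i))
      upper = count-product (λ (i , j) → upper? i j) id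


    module _ {i j} (a : Adj i j) where

      private
        i≢j : i ≢ j
        i≢j ≡.refl = irrefl i a

      edge-vector : Vector Carrier n
      edge-vector = pair i j (ι 1ℚ) (ι 1ℚ)

      edge-vector≉0 : ¬ (∀ k → edge-vector k ≈ 0#)
      edge-vector≉0 h = 1≉0 (trans (trans (sym ι-1) (trans
        (solve 0 (con 1ℚ := con 1ℚ :* con 1ℚ :+ con 1ℚ :* con 0ℚ) refl)
        (+-cong (*-congˡ (trans ι-1 (sym (δ-diagonal i))))
          (*-congˡ (trans ι-0 (sym (δ-off-diagonal (i≢j ∘ ≡.sym)))))))) (h i))

      -- The value is 1 - 2 + 1. Hence 1 - A is not positive definite, and 1 can be the left end of
      -- the first bracket.
      form-edge-vector : form (shift (ι 1ℚ) A) edge-vector ≈ 0#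
      form-edge-vector = begin
        form S edge-vector
          ≈⟨ form-pair S (shift-sym (ι 1ℚ) A A-sym) i j (ι 1ℚ) (ι 1ℚ) ⟩
        ι 1ℚ * ι 1ℚ * S i i + ι 2ℚ * (ι 1ℚ * ι 1ℚ * S i j) + ι 1ℚ * ι 1ℚ * S j j
          ≈⟨ +-cong (+-cong (*-congˡ (diagonal i)) (*-congˡ (*-congˡ off-diagonal)))
               (*-congˡ (diagonal j)) ⟩
        ι 1ℚ * ι 1ℚ * (ι 1ℚ * ι 1ℚ - ι 0ℚ) + ι 2ℚ * (ι 1ℚ * ι 1ℚ * (ι 1ℚ * ι 0ℚ - ι 1ℚ))
          + ι 1ℚ * ι 1ℚ * (ι 1ℚ * ι 1ℚ - ι 0ℚ)
          ≈⟨ solve 0 (let s = con 1ℚ :* con 1ℚ ; u = s :* (s :- con 0ℚ) in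
               u :+ con 2ℚ :* (s :* (con 1ℚ :* con 0ℚ :- con 1ℚ)) :+ u := con 0ℚ) refl ⟩
        ι 0ℚ ≈⟨ ι-0 ⟩
        0# ∎
        where
        S = shift (ι 1ℚ) A
        diagonal : ∀ k → S k k ≈ ι 1ℚ * ι 1ℚ - ι 0ℚ
        diagonal k = +-cong (*-congˡ (trans (δ-diagonal k) (sym ι-1)))
          (-‿cong (trans (A-irrefl k) (sym ι-0)))
        off-diagonal : S i j ≈ ι 1ℚ * ι 0ℚ - ι 1ℚ
        off-diagonal = +-cong (*-congˡ (trans (δ-off-diagonal i≢j) (sym ι-0)))
          (-‿cong (trans (reflexive (indicator-yes (adj? i j) a)) (sym ι-1)))

    adjacency-eigenvalue-bound : ∀ ev v → ¬ (∀ i → v i ≈ 0#) → (∀ i → (A · v) i ≈ ev * v i) →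
      ¬ Pos (ev * ev + ev - ιℕ (2 ℕ.* numEdges G))
    adjacency-eigenvalue-bound ev v v≉0 Av≈ pos =
      eigenvalue-bound A A-sym A-bit A-irrefl ev v v≉0 Av≈
        (pos-resp (+-congˡ (-‿cong (sym total≈2m))) pos)

-- The ordered algebra ℚ and definiteness of rational matrices

open +-*-Solver using (solve; _:=_; _:+_; _:*_; _:-_; :-_; con)

0≤difference⇒≤ : ∀ {p q} → 0ℚ ℚ.≤ q ℚ.- p → p ℚ.≤ q
0≤difference⇒≤ {p} {q} h = ≡.subst₂ ℚ._≤_ (ℚ.+-identityʳ p)
  (solve 2 (λ p q → p :+ (q :- p) := q) ≡.refl p q) (ℚ.+-monoʳ-≤ p h)

≤⇒0≤difference : ∀ {p q} → p ℚ.≤ q → 0ℚ ℚ.≤ q ℚ.- p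
≤⇒0≤difference {p} {q} h = ≡.subst (ℚ._≤ q ℚ.- p) (ℚ.+-inverseʳ p) (ℚ.+-monoˡ-≤ (ℚ.- p) h)

*-nonneg : ∀ {p q} → 0ℚ ℚ.≤ p → 0ℚ ℚ.≤ q → 0ℚ ℚ.≤ p ℚ.* q
*-nonneg {p} {q} 0≤p 0≤q = ≡.subst (ℚ._≤ p ℚ.* q) (ℚ.*-zeroʳ p)
  (ℚ.*-monoˡ-≤-nonNeg p {{ℚ.nonNegative 0≤p}} 0≤q)

ℚ-square-nonneg : ∀ p → 0ℚ ℚ.≤ p ℚ.* p
ℚ-square-nonneg p with ℚ.≤-total 0ℚ p
... | inj₁ 0≤p = *-nonneg 0≤p 0≤p
... | inj₂ p≤0 = ≡.subst (0ℚ ℚ.≤_) (solve 1 (λ p → :- p :* :- p := p :* p) ≡.refl p)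
  (*-nonneg (ℚ.neg-antimono-≤ p≤0) (ℚ.neg-antimono-≤ p≤0))

ℚ-*-cancel : ∀ {p q} → p ≢ 0ℚ → p ℚ.* q ≡ 0ℚ → q ≡ 0ℚ
ℚ-*-cancel {p} {q} p≢0 pq≡0 = begin
  q                      ≡⟨ ≡.sym (ℚ.*-identityʳ q) ⟩
  q ℚ.* 1ℚ               ≡⟨ ≡.cong (q ℚ.*_) (≡.sym (inv-inverse p p≢0)) ⟩
  q ℚ.* (p ℚ.* inv p) ≡⟨ solve 3 (λ p q r → q :* (p :* r) := p :* q :* r) ≡.refl p q (inv p) ⟩
  p ℚ.* q ℚ.* inv p ≡⟨ ≡.cong (ℚ._* inv p) pq≡0 ⟩
  0ℚ ℚ.* inv p      ≡⟨ ℚ.*-zeroˡ (inv p) ⟩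
  0ℚ ∎
  where open ≡.≡-Reasoning

pos⇒≢0 : ∀ {p} → 0ℚ ℚ.< p → p ≢ 0ℚ
pos⇒≢0 0<p p≡0 = ℚ.<-irrefl (≡.sym p≡0) 0<p

ℚ-algebra : OrderedAlgebra
ℚ-algebra = record
  { commutativeRing = ℚ.+-*-commutativeRing
  ; ι = id ; ι-+ = λ _ _ → ≡.refl ; ι-* = λ _ _ → ≡.refl ; ι-neg = λ _ → ≡.refl
  ; ι-0 = ≡.refl ; ι-1 = ≡.refl
  ; Pos = 0ℚ ℚ.<_ ; Nonneg = 0ℚ ℚ.≤_
  ; pos-resp = ≡.subst (0ℚ ℚ.<_) ; nonneg-resp = ≡.subst (0ℚ ℚ.≤_)
  ; pos-ι = id ; pos⇒nonneg = ℚ.<⇒≤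
  ; pos-+-nonneg = ℚ.+-mono-<-≤ ; nonneg-+ = ℚ.+-mono-≤
  ; pos-* = *-pos ; pos-*-nonneg = *-nonneg ∘ ℚ.<⇒≤
  ; square-nonneg = ℚ-square-nonneg
  ; nonneg-antisym = λ {x} 0≤x 0≤-x → ℚ.≤-antisym
      (≡.subst (ℚ._≤ 0ℚ) (solve 1 (λ x → :- (:- x) := x) ≡.refl x) (ℚ.neg-antimono-≤ 0≤-x)) 0≤x
  ; pos-asym = λ 0<x 0≤-x → ℚ.<-irrefl ≡.refl (ℚ.<-≤-trans (ℚ.neg-antimono-< 0<x) 0≤-x)
  ; pos-*-cancel = ℚ-*-cancel ∘ pos⇒≢0
  ; square-cancel = ℚ-square-cancel
  }
  where
  ℚ-square-cancel : ∀ {x} → x ℚ.* x ≡ 0ℚ → x ≡ 0ℚ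
  ℚ-square-cancel {x} x²≡0 with x ℚ.≟ 0ℚ
  ... | yes x≡0 = x≡0
  ... | no  x≢0 = ℚ-*-cancel x≢0 x²≡0

module Q = ZeroOneMatrices ℚ-algebra

ℚ-sign : ∀ x → 0ℚ ℚ.< x ⊎ x ≡ 0ℚ ⊎ 0ℚ ℚ.< ℚ.- x
ℚ-sign x with ℚ.<-cmp 0ℚ x
... | tri< 0<x _ _ = inj₁ 0<x
... | tri≈ _ 0≡x _ = inj₂ (inj₁ (≡.sym 0≡x))
... | tri> _ _ x<0 = inj₂ (inj₂ (ℚ.neg-antimono-< x<0))

open Q.Classification id id (λ a f → f a) ℚ-sign using () renaming (classify to ℚ-classify)

PositiveSemidefinite NotPositiveDefinite : ∀ {n} → Q.Mat n → Set
PositiveSemidefinite S = ∀ x → 0ℚ ℚ.≤ Q.form S x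
NotPositiveDefinite S = ∃[ x ] (¬ (∀ i → x i ≡ 0ℚ) × Q.form S x ℚ.≤ 0ℚ)

coercive⇒semidefinite : ∀ {n} (S : Q.Mat n) → Q.Coercive S → PositiveSemidefinite S
coercive⇒semidefinite S (c , d , 0<c , 0<d , bound) x =
  ℚ.*-cancelˡ-≤-pos d {{ℚ.positive 0<d}} (begin
    d ℚ.* 0ℚ        ≡⟨ ℚ.*-zeroʳ d ⟩
    0ℚ              ≤⟨ *-nonneg (ℚ.<⇒≤ 0<c) (Q.norm-nonneg x) ⟩
    c ℚ.* (x Q.∙ x) ≤⟨ 0≤difference⇒≤ (bound x) ⟩
    d ℚ.* Q.form S x ∎)
  where open ℚ.≤-Reasoning

-- The degenerate and the negative case merge, as both supply a nonzero vector with nonpositive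
-- value. A singular semidefinite matrix satisfies both alternatives and is sent to the second.
definite? : ∀ {n} (S : Q.Mat n) → Q.Sym S → PositiveSemidefinite S ⊎ NotPositiveDefinite S
definite? S S-sym with ℚ-classify S S-sym
... | inj₁ coercive = inj₁ (coercive⇒semidefinite S coercive)
... | inj₂ (inj₁ (x , x≢0 , Sx≡0)) = inj₂ (x , x≢0 , ℚ.≤-reflexive
        (Q.sum-zero (λ i → ≡.trans (≡.cong (x i ℚ.*_) (Sx≡0 i)) (ℚ.*-zeroʳ (x i)))))
... | inj₂ (inj₂ (x , neg)) = inj₂ (x
        , (λ x≡0 → ℚ.<-irrefl (≡.sym (≡.cong ℚ.-_ (Q.sum-zero (λ i →
            ≡.trans (≡.cong (ℚ._* (S Q.· x) i) (x≡0 i)) (ℚ.*-zeroˡ ((S Q.· x) i)))))) neg)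
        , ℚ.<⇒≤ (≡.subst (ℚ._< 0ℚ) (solve 1 (λ q → :- (:- q) := q) ≡.refl (Q.form S x))
            (ℚ.neg-antimono-< neg)))

-- The denominator of ε suffices: multiplied by ε it gives the numerator, which is at least 1.
archimedean : ∀ ε → 0ℚ ℚ.< ε → ∃[ q ] 1ℚ ℚ.≤ natℚ q ℚ.* ε
archimedean (mkℚ (+ zero) _ _) 0<ε = contradiction (ℚ.drop-*<* 0<ε) λ { (ℤ.+<+ ()) }
archimedean (mkℚ (-[1+ _ ]) _ _) 0<ε = contradiction (ℚ.drop-*<* 0<ε) λ ()
archimedean ε@(mkℚ (+ suc p) q-1 _) 0<ε = suc q-1 , ℚ.toℚᵘ-cancel-≤ (begin
  ℚ.toℚᵘ 1ℚ
    ≤⟨ ℚᵘ.*≤* (ℤ.+≤+ (ℕ.≤-trans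
         (ℕ.≤-reflexive (≡.trans (ℕ.*-identityˡ _) (≡.cong suc (ℕ.+-identityʳ q-1))))
         (ℕ.≤-trans (ℕ.m≤m*n (suc q-1) (suc p)) (ℕ.≤-reflexive (≡.sym (ℕ.*-identityʳ _)))))) ⟩
  ℚᵘ.mkℚᵘ (+ suc q-1) 0 ℚᵘ.* ℚ.toℚᵘ ε
    ≃⟨ ℚᵘ.*-congʳ (ℚᵘ.≃-sym (ℚ.toℚᵘ-fromℚᵘ (ℚᵘ.mkℚᵘ (+ suc q-1) 0))) ⟩
  ℚ.toℚᵘ (natℚ (suc q-1)) ℚᵘ.* ℚ.toℚᵘ ε
    ≃⟨ ℚᵘ.≃-sym (ℚ.toℚᵘ-homo-* (natℚ (suc q-1)) ε) ⟩
  ℚ.toℚᵘ (natℚ (suc q-1) ℚ.* ε) ∎)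
  where open ℚᵘ.≤-Reasoning

-- Bisection

width : ℚ → ℕ → ℚ
width w zero    = w
width w (suc k) = ½ ℚ.* width w k

width-nonneg : ∀ {w} → 0ℚ ℚ.≤ w → ∀ k → 0ℚ ℚ.≤ width w k
width-nonneg 0≤w zero    = 0≤w
width-nonneg 0≤w (suc k) = *-nonneg (ℚ.nonNegative⁻¹ ½) (width-nonneg 0≤w k)

-- This is 2ᵏ ≥ k + 1 in disguise. Passing from k to k + 1 lowers the left side by ½ k `width w k`.
width-bound : ∀ {w} → 0ℚ ℚ.≤ w → ∀ k → natℚ (suc k) ℚ.* width w k ℚ.≤ w
width-bound {w} 0≤w zero = ℚ.≤-reflexive (ℚ.*-identityˡ w)
width-bound {w} 0≤w (suc k) = ℚ.≤-trans (0≤difference⇒≤ (≡.subst (0ℚ ℚ.≤_)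
    (≡.trans
      (solve 2 (λ m u → con ½ :* (m :* u)
        := (con 1ℚ :+ m) :* u :- (con 1ℚ :+ (con 1ℚ :+ m)) :* (con ½ :* u)) ≡.refl (natℚ k) (width w k))
      (≡.sym (≡.cong₂ (λ a b → a ℚ.* width w k ℚ.- b ℚ.* (½ ℚ.* width w k))
        (natℚ-+ 1 k) (≡.trans (natℚ-+ 1 (suc k)) (≡.cong (1ℚ ℚ.+_) (natℚ-+ 1 k))))))
    (*-nonneg (ℚ.nonNegative⁻¹ ½) (*-nonneg (natℚ-nonneg k) (width-nonneg 0≤w k)))))
  (width-bound 0≤w k)

width-vanishes : ∀ M ε → 0ℚ ℚ.< ε → ∃[ k ] width (natℚ M) k ℚ.< ε
width-vanishes M ε 0<ε =
  let q , 1≤qε = archimedean ε 0<ε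
      -- With 1 ≤ qε, the chain is (k + 1) `width` ≤ M ≤ Mqε = kε < (k + 1)ε.
      k = M ℕ.* q
  in k , ℚ.*-cancelˡ-<-nonNeg (natℚ (suc k)) {{ℚ.nonNegative (natℚ-nonneg (suc k))}} (begin-strict
    natℚ (suc k) ℚ.* width (natℚ M) k ≤⟨ width-bound (natℚ-nonneg M) k ⟩
    natℚ M                            ≡⟨ ≡.sym (ℚ.*-identityʳ (natℚ M)) ⟩
    natℚ M ℚ.* 1ℚ                     ≤⟨ ℚ.*-monoˡ-≤-nonNeg (natℚ M) {{ℚ.nonNegative (natℚ-nonneg M)}} 1≤qε ⟩
    natℚ M ℚ.* (natℚ q ℚ.* ε)         ≡⟨ ≡.sym (ℚ.*-assoc (natℚ M) (natℚ q) ε) ⟩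
    natℚ M ℚ.* natℚ q ℚ.* ε           ≡⟨ ≡.cong (ℚ._* ε) (≡.sym (natℚ-* M q)) ⟩
    natℚ k ℚ.* ε                      ≡⟨ ≡.sym (ℚ.+-identityˡ _) ⟩
    0ℚ ℚ.+ natℚ k ℚ.* ε               <⟨ ℚ.+-monoˡ-< (natℚ k ℚ.* ε) 0<ε ⟩
    ε ℚ.+ natℚ k ℚ.* ε                ≡⟨ solve 2 (λ m e → e :+ m :* e := (con 1ℚ :+ m) :* e) ≡.refl (natℚ k) ε ⟩
    (1ℚ ℚ.+ natℚ k) ℚ.* ε             ≡⟨ ≡.cong (ℚ._* ε) (≡.sym (natℚ-+ 1 k)) ⟩
    natℚ (suc k) ℚ.* ε ∎)
  where open ℚ.≤-Reasoning

-- The upper ends become the approximations of the real `top`, so that every approximation of top -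
-- A is exactly positive semidefinite. From index j on they exceed `lower j` by at most `w j`, so
-- the witness in `lower-npd` is nearly null for top - A.
record Bracketing {n} (A : Q.Mat n) : Set where
  field
    lower upper w   : ℕ → ℚ
    lower-npd       : ∀ k → NotPositiveDefinite (Q.shift (lower k) A)
    upper-psd       : ∀ k → PositiveSemidefinite (Q.shift (upper k) A)
    upper-bound     : ∀ {j k} → j ℕ.≤ k → upper k ℚ.≤ lower j ℚ.+ w j
    w-vanishes      : ∀ ε → 0ℚ ℚ.< ε → ∃[ k ] w k ℚ.< ε
    1≤upper         : ∀ k → 1ℚ ℚ.≤ upper k
    upper-cauchy    : IsCauchy upper

module Bisection {n} (A : Q.Mat n) (A-sym : Q.Sym A) (M : ℕ)
  (start-low  : NotPositiveDefinite (Q.shift 1ℚ A))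
  (start-high : PositiveSemidefinite (Q.shift (1ℚ ℚ.+ natℚ M) A)) where

  Bracket : ℚ → Set
  Bracket w = Σ[ l ∈ ℚ ] (NotPositiveDefinite (Q.shift l A) × PositiveSemidefinite (Q.shift (l ℚ.+ w) A))

  halve : ∀ w → Bracket w → Bracket (½ ℚ.* w)
  halve w (l , low , high) with definite? _ (Q.shift-sym (l ℚ.+ ½ ℚ.* w) A A-sym)
  ... | inj₁ high′ = l , low , high′
  ... | inj₂ low′  = l ℚ.+ ½ ℚ.* w , low′ , ≡.subst (λ t → PositiveSemidefinite (Q.shift t A))
          (solve 2 (λ l w → l :+ w := l :+ con ½ :* w :+ con ½ :* w) ≡.refl l w) high

  bracket : ∀ k → Bracket (width (natℚ M) k)
  bracket zero    = 1ℚ , start-low , start-high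
  bracket (suc k) = halve _ (bracket k)

  w lower upper : ℕ → ℚ
  w         = width (natℚ M)
  lower k   = proj₁ (bracket k)
  upper k   = lower k ℚ.+ w k

  lower-npd : ∀ k → NotPositiveDefinite (Q.shift (lower k) A)
  lower-npd k = proj₁ (proj₂ (bracket k))

  upper-psd : ∀ k → PositiveSemidefinite (Q.shift (upper k) A)
  upper-psd k = proj₂ (proj₂ (bracket k))

  w-nonneg : ∀ k → 0ℚ ℚ.≤ w k
  w-nonneg = width-nonneg (natℚ-nonneg M)

  halve-nested : ∀ v (b : Bracket v) → 0ℚ ℚ.≤ v →
    let l = proj₁ b ; l′ = proj₁ (halve v b) in
    l ℚ.≤ l′ × l′ ℚ.+ ½ ℚ.* v ℚ.≤ l ℚ.+ v
  halve-nested v (l , low , high) 0≤v with definite? _ (Q.shift-sym (l ℚ.+ ½ ℚ.* v) A A-sym)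
  ... | inj₁ _ = ℚ.≤-refl , 0≤difference⇒≤ (≡.subst (0ℚ ℚ.≤_)
          (solve 2 (λ l v → con ½ :* v := l :+ v :- (l :+ con ½ :* v)) ≡.refl l v)
          (*-nonneg (ℚ.nonNegative⁻¹ ½) 0≤v))
  ... | inj₂ _ = 0≤difference⇒≤ (≡.subst (0ℚ ℚ.≤_)
          (solve 2 (λ l v → con ½ :* v := l :+ con ½ :* v :- l) ≡.refl l v)
          (*-nonneg (ℚ.nonNegative⁻¹ ½) 0≤v))
      , ℚ.≤-reflexive (solve 2 (λ l v → l :+ con ½ :* v :+ con ½ :* v := l :+ v) ≡.refl l v)

  nested : ∀ j d → lower j ℚ.≤ lower (d ℕ.+ j) × upper (d ℕ.+ j) ℚ.≤ upper j
  nested j zero    = ℚ.≤-refl , ℚ.≤-refl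
  nested j (suc d) =
    let l≤ , u≤   = nested j d
        l≤′ , u≤′ = halve-nested _ (bracket (d ℕ.+ j)) (w-nonneg (d ℕ.+ j))
    in ℚ.≤-trans l≤ l≤′ , ℚ.≤-trans u≤′ u≤

  within : ∀ {j k} → j ℕ.≤ k → lower j ℚ.≤ upper k × upper k ℚ.≤ upper j
  within {j} {k} j≤k = ≡.subst (λ k → lower j ℚ.≤ upper k × upper k ℚ.≤ upper j) (ℕ.m∸n+n≡m j≤k)
    ( ℚ.≤-trans (proj₁ (nested j d)) (0≤difference⇒≤ (≡.subst (0ℚ ℚ.≤_)
        (solve 2 (λ l v → v := l :+ v :- l) ≡.refl (lower (d ℕ.+ j)) (w (d ℕ.+ j))) (w-nonneg (d ℕ.+ j))))
    , proj₂ (nested j d))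
    where d = k ℕ.∸ j

  1≤upper : ∀ k → 1ℚ ℚ.≤ upper k
  -- The starting value `lower 0` is 1.
  1≤upper k = proj₁ (within {0} {k} ℕ.z≤n)

  upper-cauchy : IsCauchy upper
  upper-cauchy ε 0<ε =
    let N , wN<ε = width-vanishes M ε 0<ε in
    N , λ i j N≤i N≤j →
      let l≤i , i≤u = within N≤i
          l≤j , j≤u = within N≤j
      in ℚ.≤-<-trans (∣difference∣≤ l≤i i≤u l≤j j≤u) wN<ε
    where
    one-sided : ∀ {l v p q} → l ℚ.≤ q → p ℚ.≤ l ℚ.+ v → p ℚ.- q ℚ.≤ v
    one-sided {l} {v} {p} {q} l≤q p≤u = 0≤difference⇒≤ (≡.subst (0ℚ ℚ.≤_)
      (solve 4 (λ l v p q → (q :- l) :+ (l :+ v :- p) := v :- (p :- q)) ≡.refl l v p q)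
      (ℚ.+-mono-≤ (≤⇒0≤difference l≤q) (≤⇒0≤difference p≤u)))
    ∣difference∣≤ : ∀ {l v p q} → l ℚ.≤ p → p ℚ.≤ l ℚ.+ v → l ℚ.≤ q → q ℚ.≤ l ℚ.+ v → ℚ.∣ p ℚ.- q ∣ ℚ.≤ v
    ∣difference∣≤ {l} {v} {p} {q} l≤p p≤u l≤q q≤u with ℚ.∣p∣≡p∨∣p∣≡-p (p ℚ.- q)
    ... | inj₁ e = ≡.subst (ℚ._≤ v) (≡.sym e) (one-sided l≤q p≤u)
    ... | inj₂ e = ≡.subst (ℚ._≤ v)
            (≡.trans (solve 2 (λ p q → q :- p := :- (p :- q)) ≡.refl p q) (≡.sym e)) (one-sided l≤p q≤u)

  bracketing : Bracketing A
  bracketing = record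
    { lower = lower ; upper = upper ; w = w ; lower-npd = lower-npd ; upper-psd = upper-psd
    ; upper-bound = proj₂ ∘ within ; w-vanishes = width-vanishes M ; 1≤upper = 1≤upper
    ; upper-cauchy = upper-cauchy }

-- Estimates that hold eventually

Eventually : (ℕ → Set) → Set
Eventually P = ∃[ N ] (∀ i → N ℕ.≤ i → P i)

always : ∀ {P} → (∀ i → P i) → Eventually P
always h = 0 , λ i _ → h i

ev-map : ∀ {P R} → (∀ i → P i → R i) → Eventually P → Eventually R
ev-map f (N , h) = N , λ i N≤i → f i (h i N≤i)

infixr 4 _∧ᵉ_

_∧ᵉ_ : ∀ {P R} → Eventually P → Eventually R → Eventually (λ i → P i × R i)
(M , f) ∧ᵉ (N , g) = M ℕ.⊔ N , λ i M⊔N≤i →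
  f i (ℕ.m⊔n≤o⇒m≤o M N M⊔N≤i) , g i (ℕ.m⊔n≤o⇒n≤o M N M⊔N≤i)

-- Inequalities are proved by certificates: d is assembled from differences already known to be
-- nonnegative, and the ring solver checks that it equals q - p.
≤-from : ∀ {p q} d → d ≡ q ℚ.- p → 0ℚ ℚ.≤ d → p ℚ.≤ q
≤-from d e h = 0≤difference⇒≤ (≡.subst (0ℚ ℚ.≤_) e h)

half< : ∀ {ε} → 0ℚ ℚ.< ε → ½ ℚ.* ε ℚ.< ε
half< {ε} 0<ε = ≡.subst₂ ℚ._<_ (ℚ.+-identityʳ (½ ℚ.* ε)) (half+half ε)
  (ℚ.+-monoʳ-< (½ ℚ.* ε) (half-pos 0<ε))

∣∣≤ : ∀ {p b} → p ℚ.≤ b → ℚ.- p ℚ.≤ b → ∣ p ∣ ℚ.≤ b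
∣∣≤ {p} {b} p≤b -p≤b with ℚ.∣p∣≡p∨∣p∣≡-p p
... | inj₁ e = ≡.subst (ℚ._≤ b) (≡.sym e) p≤b
... | inj₂ e = ≡.subst (ℚ._≤ b) (≡.sym e) -p≤b

∣-∣-sym : ∀ p q → ∣ p ℚ.- q ∣ ≡ ∣ q ℚ.- p ∣
∣-∣-sym p q = ≡.trans (≡.cong ∣_∣ (solve 2 (λ p q → p :- q := :- (q :- p)) ≡.refl p q))
  (ℚ.∣-p∣≡∣p∣ (q ℚ.- p))

close : ∀ p q {ε} → ∣ p ℚ.- q ∣ ℚ.< ε → p ℚ.≤ q ℚ.+ ε
close p q {ε} h = ≤-from (ε ℚ.- (p ℚ.- q))
  (solve 3 (λ p q e → e :- (p :- q) := q :+ e :- p) ≡.refl p q ε)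
  (≤⇒0≤difference (ℚ.≤-trans (p≤∣p∣ (p ℚ.- q)) (ℚ.<⇒≤ h)))

close′ : ∀ p q {ε} → ∣ p ℚ.- q ∣ ℚ.< ε → q ℚ.≤ p ℚ.+ ε
close′ p q {ε} h = close q p (≡.subst (ℚ._< ε) (∣-∣-sym p q) h)


-- at x k stands for the k-th rational approximation of x.
record RealModel : Set₁ where
  field
    algebra : OrderedAlgebra
  open OrderedAlgebra algebra public using (Carrier)
  open OrderedAlgebra algebra hiding (Carrier)
  field
    at         : Carrier → ℕ → ℚ
    at-ι       : ∀ q k → at (ι q) k ≡ q
    at-0       : ∀ k → at 0# k ≡ 0ℚ
    at-1       : ∀ k → at 1# k ≡ 1ℚ
    at-+       : ∀ x y k → at (x + y) k ≡ at x k ℚ.+ at y k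
    at-*       : ∀ x y k → at (x * y) k ≡ at x k ℚ.* at y k
    at-neg     : ∀ x k → at (- x) k ≡ ℚ.- at x k
    pos-at     : ∀ {x} → Pos x → ∃[ δ ] (0ℚ ℚ.< δ × Eventually (λ k → δ ℚ.≤ at x k))
    nonneg-at  : ∀ {x} → Nonneg x → ∀ ε → 0ℚ ℚ.< ε → Eventually (λ k → 0ℚ ℚ.≤ at x k ℚ.+ ε)
    at-nonneg  : ∀ {x} → (∀ k → 0ℚ ℚ.≤ at x k) → Nonneg x
    at-bounded : ∀ x → ∃[ B ] (0ℚ ℚ.< B × Eventually (λ k → ∣ at x k ∣ ℚ.≤ B))
    pointwise-≈ : ∀ {x y} → (∀ k → at x k ≡ at y k) → x ≈ y
    ¬¬sign     : ∀ x → ¬ ¬ (Pos x ⊎ x ≈ 0# ⊎ Pos (- x))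

-- F stands for the value of the form at a vector of squared norm N. Then dF ≤ BwN ≤ BδN = ½γN,
-- while cN ≥ γN, so dF - cN ≤ -½γN, a deficit that the tolerance ¼γN cannot make up.
coercivity-gap : ∀ {B γ δ N w c d F} → 0ℚ ℚ.< B → 0ℚ ℚ.< γ → B ℚ.* δ ≡ ½ ℚ.* γ → 0ℚ ℚ.< N →
  w ℚ.≤ δ → γ ℚ.≤ c → ∣ d ∣ ℚ.≤ B → 0ℚ ℚ.≤ F → F ℚ.≤ w ℚ.* N →
  ¬ 0ℚ ℚ.≤ d ℚ.* F ℚ.- c ℚ.* N ℚ.+ ½ ℚ.* (½ ℚ.* γ ℚ.* N)
coercivity-gap {B} {γ} {δ} {N} {w} {c} {d} {F} 0<B 0<γ Bδ 0<N w≤δ γ≤c d≤B 0≤F F≤wN h =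
  ℚ.<-irrefl ≡.refl (ℚ.<-≤-trans (ℚ.neg-antimono-< 0<ε) (≡.subst (0ℚ ℚ.≤_)
    (≡.trans
      (solve 8 (λ B g δ N w c d F →
        (d :* F :- c :* N :+ con ½ :* (con ½ :* g :* N)) :+ (c :- g) :* N :+ (B :- d) :* F
          :+ B :* (w :* N :- F) :+ B :* ((δ :- w) :* N)
        := B :* δ :* N :+ con ½ :* (con ½ :* g :* N) :- g :* N) ≡.refl B γ δ N w c d F)
      (≡.trans (≡.cong (λ t → t ℚ.* N ℚ.+ ε ℚ.- γ ℚ.* N) Bδ)
        (solve 2 (λ g N → con ½ :* g :* N :+ con ½ :* (con ½ :* g :* N) :- g :* N
          := :- (con ½ :* (con ½ :* g :* N))) ≡.refl γ N)))
    (ℚ.+-mono-≤ (ℚ.+-mono-≤ (ℚ.+-mono-≤ (ℚ.+-mono-≤ h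
      (*-nonneg (≤⇒0≤difference γ≤c) (ℚ.<⇒≤ 0<N)))
      (*-nonneg (≤⇒0≤difference (ℚ.≤-trans (p≤∣p∣ d) d≤B)) 0≤F))
      (*-nonneg (ℚ.<⇒≤ 0<B) (≤⇒0≤difference F≤wN)))
      (*-nonneg (ℚ.<⇒≤ 0<B) (*-nonneg (≤⇒0≤difference w≤δ) (ℚ.<⇒≤ 0<N))))))
  where
  ε = ½ ℚ.* (½ ℚ.* γ ℚ.* N)
  0<ε : 0ℚ ℚ.< ε
  0<ε = half-pos (*-pos (half-pos 0<γ) 0<N)

module _ {n} (G : SimpleGraph n) where
  open SimpleGraph G
  private module QA = Q.Adjacency G

  -- The part 2m comes from `rayleigh-bound`. The summand 1 is the left end of the first bracket,
  -- whose length is thus the natural number 2m.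
  shift-semidefinite : PositiveSemidefinite (Q.shift (1ℚ ℚ.+ natℚ (2 ℕ.* numEdges G)) QA.A)
  shift-semidefinite x = ≡.subst (0ℚ ℚ.≤_)
    (≡.trans
      (solve 3 (λ t N q → N :+ con ½ :* (con Q.2ℚ :* (t :* N :- q)) := (con 1ℚ :+ t) :* N :- q)
        ≡.refl 2m (x Q.∙ x) (Q.form QA.A x))
      (≡.sym (Q.form-shift (1ℚ ℚ.+ 2m) QA.A x)))
    (ℚ.+-mono-≤ (Q.norm-nonneg x) (*-nonneg (ℚ.nonNegative⁻¹ ½)
      (≡.subst (λ t → 0ℚ ℚ.≤ Q.2ℚ ℚ.* (t ℚ.* (x Q.∙ x) ℚ.- Q.form QA.A x)) QA.total≈2m
        (Q.rayleigh-bound QA.A QA.A-sym QA.A-bit QA.A-irrefl x))))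
    where
    2m : ℚ
    2m = natℚ (2 ℕ.* numEdges G)

  adjacency-bracketing : ∀ {i j} → Adj i j → Bracketing QA.A
  adjacency-bracketing a = Bisection.bracketing QA.A QA.A-sym (2 ℕ.* numEdges G)
    (QA.edge-vector a , QA.edge-vector≉0 a , ℚ.≤-reflexive (QA.form-edge-vector a))
    shift-semidefinite

-- Over ℝ, comparing _·_ with the product _*ᵥ_ of Defs by conversion unfolds proofs of convergence and
-- does not finish, so the action of A is a parameter that is known only through its approximations.
module Spectrum (model : RealModel) {n : ℕ} (G : SimpleGraph n)
  (act : Vector (RealModel.Carrier model) n → Vector (RealModel.Carrier model) n)
  (at-act : ∀ x i k → RealModel.at model (act x i) k
                        ≡ (Q.Adjacency.A G Q.· (λ j → RealModel.at model (x j) k)) i)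
  where

  open RealModel model
  open ZeroOneMatrices algebra hiding (Carrier)
  open Adjacency G
  open Classification (λ P → ¬ ¬ P) (λ a k → k a) (λ m f k → m λ a → f a k) ¬¬sign
  open RingProperties ring using (-‿involutive; x∙y⁻¹≈ε⇒x≈y)
  private
    T : Q.Mat n
    T = Q.Adjacency.A G

  at-sum : ∀ {m} (f : Vector Carrier m) k → at (sum f) k ≡ Q.sum (λ i → at (f i) k)
  at-sum {zero}  f k = at-0 k
  at-sum {suc m} f k = ≡.trans (at-+ (f zero) (sum (tail f)) k)
    (≡.cong (at (f zero) k ℚ.+_) (at-sum (tail f) k))

  at-∙ : ∀ {m} (x y : Vector Carrier m) k → at (x ∙ y) k ≡ (λ i → at (x i) k) Q.∙ (λ i → at (y i) k)
  at-∙ x y k = ≡.trans (at-sum (λ i → x i * y i) k) (Q.sum-cong-≋ (λ i → at-* (x i) (y i) k))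

  at-indicator : ∀ {P : Set} (P? : Dec P) k → at (indicator P?) k ≡ Q.indicator P?
  at-indicator (yes _) k = at-1 k
  at-indicator (no _)  k = at-0 k

  at-· : ∀ x i k → at ((A · x) i) k ≡ (T Q.· (λ j → at (x j) k)) i
  at-· x i k = ≡.trans (at-∙ (A i) x k) (Q.sum-cong-≋ λ j →
    ≡.cong (ℚ._* at (x j) k) (at-indicator (SimpleGraph.adj? G i j) k))

  at-form : ∀ x k → at (form A x) k ≡ Q.form T (λ i → at (x i) k)
  at-form x k = ≡.trans (at-∙ x (A · x) k)
    (Q.sum-cong-≋ λ i → ≡.cong (at (x i) k ℚ.*_) (at-· x i k))

  act≈A : ∀ x i → act x i ≈ (A · x) i
  act≈A x i = pointwise-≈ λ k → ≡.trans (at-act x i k) (≡.sym (at-· x i k))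

  act-eigenvalue-bound : ∀ ev v → ¬ (∀ i → v i ≈ 0#) → (∀ i → act v i ≈ ev * v i) →
    ¬ Pos (ev * ev + ev - ιℕ (2 ℕ.* numEdges G))
  act-eigenvalue-bound ev v v≉0 Av≈ =
    adjacency-eigenvalue-bound ev v v≉0 (λ i → trans (sym (act≈A v i)) (Av≈ i))

  module _ (b : Bracketing T) (top : Carrier) (at-top : ∀ k → at top k ≡ Bracketing.upper b k) where

    open Bracketing b
    private
      S : Mat n
      S = shift top A

    at-form-shift : ∀ x k → at (top * (x ∙ x) - form A x) k ≡ Q.form (Q.shift (upper k) T) (λ i → at (x i) k)
    at-form-shift x k = ≡.trans (at-+ (top * (x ∙ x)) (- form A x) k) (≡.trans
      (≡.cong₂ ℚ._+_
        (≡.trans (at-* top (x ∙ x) k) (≡.cong₂ ℚ._*_ (at-top k) (at-∙ x x k)))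
        (≡.trans (at-neg (form A x) k) (≡.cong ℚ.-_ (at-form x k))))
      (≡.sym (Q.form-shift (upper k) T (λ i → at (x i) k))))

    -- Every approximation of `top` is an upper end, so the form is nonnegative already at each
    -- index.
    top-not-negative : ¬ Negative S
    top-not-negative (x , neg) = pos-asym neg (nonneg-resp
      (trans (sym (form-shift top A x)) (sym (-‿involutive (form S x))))
      (at-nonneg λ k → ≡.subst (0ℚ ℚ.≤_) (≡.sym (at-form-shift x k)) (upper-psd k (λ i → at (x i) k))))

    -- The vector witnessing that lower j − A is not positive definite has Rayleigh quotient at most
    -- w j with respect to top − A.
    quotient-bound : ∀ x j k → j ℕ.≤ k → Q.form (Q.shift (lower j) T) x ℚ.≤ 0ℚ →
      Q.form (Q.shift (upper k) T) x ℚ.≤ w j ℚ.* (x Q.∙ x)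
    quotient-bound x j k j≤k low =
      ≡.subst (ℚ._≤ w j ℚ.* N) (≡.sym (Q.form-shift (upper k) T x)) (≤-from _
        (solve 5 (λ l v u N q → (l :+ v :- u) :* N :+ (con 0ℚ :- (l :* N :- q)) := v :* N :- (u :* N :- q))
          ≡.refl (lower j) (w j) (upper k) N (Q.form T x))
        (ℚ.+-mono-≤
          (*-nonneg (≤⇒0≤difference (upper-bound j≤k)) (Q.norm-nonneg x))
          (≤⇒0≤difference (≡.subst (ℚ._≤ 0ℚ) (Q.form-shift (lower j) T x) low))))
      where N = x Q.∙ x

    -- With c ≥ γ and d ≤ B eventually, coercivity would keep Rayleigh quotients above γ / B, but
    -- the witness for `lower j` has quotient at most w j, which is made smaller than δ = γ / 2B.
    -- All estimates are compared at one late index k, where the witness embedded by ι has its exact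
    -- rational value.
    top-not-coercive : ¬ Coercive S
    top-not-coercive (c , d , c-pos , d-pos , bound) =
      let γ , 0<γ , γ≤c   = pos-at c-pos
          B , 0<B , d≤B   = at-bounded d
          δ , 0<δ , Bδ    = shrink 0<B 0<γ
          j , wj<δ        = w-vanishes δ 0<δ
          x , x≢0 , Qx≤0  = lower-npd j
          y               = λ i → ι (x i)
          N               = x Q.∙ x
          0<N             = ℚ.≰⇒> (λ N≤0 → x≢0 (Q.norm-zero x (ℚ.neg-antimono-≤ N≤0)))
          k , late        = γ≤c ∧ᵉ d≤B ∧ᵉ (j , λ i j≤i → j≤i)
                              ∧ᵉ nonneg-at (nonneg-resp (+-congʳ (*-congˡ (form-shift top A y))) (bound y))
                                   _ (half-pos (*-pos (half-pos 0<γ) 0<N))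
          γ≤ck , dk≤B , j≤k , h = late k ℕ.≤-refl
      in coercivity-gap 0<B 0<γ Bδ 0<N (ℚ.<⇒≤ wj<δ) γ≤ck dk≤B (upper-psd k x)
           (quotient-bound x j k j≤k Qx≤0)
           (≡.subst (λ q → 0ℚ ℚ.≤ q ℚ.+ ½ ℚ.* (½ ℚ.* γ ℚ.* N)) (at-difference c d x k) h)
      where
      at-difference : ∀ c d (x : Vector ℚ n) k → let y = λ i → ι (x i) in
        at (d * (top * (y ∙ y) - form A y) - c * (y ∙ y)) k
          ≡ at d k ℚ.* Q.form (Q.shift (upper k) T) x ℚ.- at c k ℚ.* (x Q.∙ x)
      at-difference c d x k = ≡.trans (at-+ _ _ k) (≡.cong₂ ℚ._+_
        (≡.trans (at-* d _ k) (≡.cong (at d k ℚ.*_) (≡.trans (at-form-shift y k)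
          (Q.form-congʳ (Q.shift (upper k) T) (λ i → at-ι (x i) k)))))
        (≡.trans (at-neg _ k) (≡.cong ℚ.-_ (≡.trans (at-* c _ k) (≡.cong (at c k ℚ.*_)
          (≡.trans (at-∙ y y k) (Q.sum-cong-≋ λ i → ≡.cong₂ ℚ._*_ (at-ι (x i) k) (at-ι (x i) k))))))))
        where
        y : Vector Carrier n
        y i = ι (x i)

    top-eigenvalue : ¬ ¬ (∃[ x ] (¬ (∀ i → x i ≈ 0#) × ∀ i → act x i ≈ top * x i))
    top-eigenvalue k = classify S (shift-sym top A A-sym) λ where
      (inj₁ coercive) → top-not-coercive coercive
      (inj₂ (inj₂ negative)) → top-not-negative negative
      (inj₂ (inj₁ (x , x≉0 , Sx≈0))) → k (x , x≉0 , λ i →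
        trans (act≈A x i) (sym (x∙y⁻¹≈ε⇒x≈y _ _ (trans (sym (shift-· top A x i)) (Sx≈0 i)))))

-- The ordered algebra ℝ

open import Defs

pointwise : ∀ {x y} → (∀ i → seq x i ≡ seq y i) → x ≃ y
pointwise {x} {y} h ε 0<ε = always λ i → ≡.subst (λ d → ∣ d ∣ ℚ.< ε)
  (≡.sym (≡.trans (≡.cong (ℚ._- seq y i) (h i)) (ℚ.+-inverseʳ (seq y i)))) 0<ε

≃-sym : ∀ {x y} → x ≃ y → y ≃ x
≃-sym {x} {y} h ε 0<ε = ev-map (λ i → ≡.subst (ℚ._< ε) (∣-∣-sym (seq x i) (seq y i))) (h ε 0<ε)

∣∣-triangle : ∀ {ε} p q → 0ℚ ℚ.< ε → ∣ p ∣ ℚ.< ½ ℚ.* ε → ∣ q ∣ ℚ.< ½ ℚ.* ε → ∣ p ℚ.+ q ∣ ℚ.< ε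
∣∣-triangle {ε} p q 0<ε hp hq = ≡.subst (∣ p ℚ.+ q ∣ ℚ.<_) (half+half ε)
  (ℚ.≤-<-trans (ℚ.∣p+q∣≤∣p∣+∣q∣ p q) (ℚ.+-mono-< hp hq))

≃-trans : ∀ {x y z} → x ≃ y → y ≃ z → x ≃ z
≃-trans {x} {y} {z} h k ε 0<ε = ev-map
  (λ i (p , q) → ≡.subst (λ d → ∣ d ∣ ℚ.< ε)
    (solve 3 (λ a b c → (a :- b) :+ (b :- c) := a :- c) ≡.refl (seq x i) (seq y i) (seq z i))
    (∣∣-triangle _ _ 0<ε p q))
  (h (½ ℚ.* ε) (half-pos 0<ε) ∧ᵉ k (½ ℚ.* ε) (half-pos 0<ε))

+-congℝ : ∀ {x y u v} → x ≃ y → u ≃ v → x + u ≃ y + v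
+-congℝ {x} {y} {u} {v} h k ε 0<ε = ev-map
  (λ i (p , q) → ≡.subst (λ d → ∣ d ∣ ℚ.< ε)
    (solve 4 (λ a b c d → (a :- b) :+ (c :- d) := (a :+ c) :- (b :+ d)) ≡.refl
      (seq x i) (seq y i) (seq u i) (seq v i))
    (∣∣-triangle _ _ 0<ε p q))
  (h (½ ℚ.* ε) (half-pos 0<ε) ∧ᵉ k (½ ℚ.* ε) (half-pos 0<ε))

*-congℝ : ∀ {x y u v} → x ≃ y → u ≃ v → x * u ≃ y * v
*-congℝ {x} {y} {u} {v} h k ε 0<ε =
  let B , 0<B , y≤B = bounded {seq y} (cauchy y)
      C , 0<C , u≤C = bounded {seq u} (cauchy u)
      δ , 0<δ , Cδ  = shrink 0<C 0<ε
      η , 0<η , Bη  = shrink 0<B 0<ε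
  in ev-map (λ i (y≤ , u≤ , p , q) →
        *-estimate (seq x i) (seq u i) (seq y i) (seq v i) 0<B 0<C Cδ Bη y≤ u≤ p q)
      (y≤B ∧ᵉ u≤C ∧ᵉ h δ 0<δ ∧ᵉ k η 0<η)

abstract
  neg-cauchy : ∀ {s} → IsCauchy s → IsCauchy (λ i → ℚ.- s i)
  neg-cauchy {s} s-cauchy ε 0<ε =
    let N , h = s-cauchy ε 0<ε in
    N , λ i j N≤i N≤j → ≡.subst (λ d → ∣ d ∣ ℚ.< ε)
      (solve 2 (λ a b → b :- a := :- a :- :- b) ≡.refl (s i) (s j)) (h j i N≤j N≤i)

infix 8 -ℝ_

-ℝ_ : ℝ → ℝ
-ℝ x = mkℝ (λ i → ℚ.- seq x i) (neg-cauchy {seq x} (cauchy x))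

-ℝ-cong : ∀ {x y} → x ≃ y → -ℝ x ≃ -ℝ y
-ℝ-cong {x} {y} h ε 0<ε = ev-map
  (λ i → ≡.subst (ℚ._< ε) (≡.trans (∣-∣-sym (seq x i) (seq y i))
    (≡.cong ∣_∣ (solve 2 (λ a b → b :- a := :- a :- :- b) ≡.refl (seq x i) (seq y i)))))
  (h ε 0<ε)

ℝ-commutativeRing : CommutativeRing 0ℓ 0ℓ
ℝ-commutativeRing = record
  { Carrier = ℝ ; _≈_ = _≃_ ; _+_ = _+_ ; _*_ = _*_ ; -_ = -ℝ_ ; 0# = 0ℝ ; 1# = 1ℝ
  ; isCommutativeRing = record
    { isRing = record
      { +-isAbelianGroup = record
        { isGroup = record
          { isMonoid = record
            { isSemigroup = record
              { isMagma = record
                { isEquivalence = record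
                  { refl  = λ {x} → pointwise {x} {x} λ _ → ≡.refl
                  ; sym   = λ {x} {y} → ≃-sym {x} {y}
                  ; trans = λ {x} {y} {z} → ≃-trans {x} {y} {z} }
                ; ∙-cong = λ {x} {y} {u} {v} → +-congℝ {x} {y} {u} {v} }
              ; assoc = λ x y z → pointwise {(x + y) + z} {x + (y + z)}
                  λ i → ℚ.+-assoc (seq x i) (seq y i) (seq z i) }
            ; identity = (λ x → pointwise {0ℝ + x} {x} λ i → ℚ.+-identityˡ (seq x i))
                       , (λ x → pointwise {x + 0ℝ} {x} λ i → ℚ.+-identityʳ (seq x i)) }
          ; inverse = (λ x → pointwise { -ℝ x + x} {0ℝ} λ i → ℚ.+-inverseˡ (seq x i))
                    , (λ x → pointwise {x + -ℝ x} {0ℝ} λ i → ℚ.+-inverseʳ (seq x i))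
          ; ⁻¹-cong = λ {x} {y} → -ℝ-cong {x} {y} }
        ; comm = λ x y → pointwise {x + y} {y + x} λ i → ℚ.+-comm (seq x i) (seq y i) }
      ; *-cong = λ {x} {y} {u} {v} → *-congℝ {x} {y} {u} {v}
      ; *-assoc = λ x y z → pointwise {(x * y) * z} {x * (y * z)}
          λ i → ℚ.*-assoc (seq x i) (seq y i) (seq z i)
      ; *-identity = (λ x → pointwise {1ℝ * x} {x} λ i → ℚ.*-identityˡ (seq x i))
                   , (λ x → pointwise {x * 1ℝ} {x} λ i → ℚ.*-identityʳ (seq x i))
      ; distrib = (λ x y z → pointwise {x * (y + z)} {x * y + x * z}
                     λ i → ℚ.*-distribˡ-+ (seq x i) (seq y i) (seq z i))
                , (λ x y z → pointwise {(y + z) * x} {y * x + z * x}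
                     λ i → ℚ.*-distribʳ-+ (seq x i) (seq y i) (seq z i)) }
    ; *-comm = λ x y → pointwise {x * y} {y * x} λ i → ℚ.*-comm (seq x i) (seq y i) } }

Positive Nonnegative : ℝ → Set
Positive x    = 0ℝ < x
Nonnegative x = 0ℝ ≤ x

positive-elim : ∀ {x} → Positive x → ∃[ δ ] (0ℚ ℚ.< δ × Eventually (λ i → δ ℚ.≤ seq x i))
positive-elim {x} (δ , 0<δ , h) =
  δ , 0<δ , ev-map (λ i → ≡.subst (ℚ._≤ seq x i) (ℚ.+-identityˡ δ)) h

positive-intro : ∀ {x} δ → 0ℚ ℚ.< δ → Eventually (λ i → δ ℚ.≤ seq x i) → Positive x
positive-intro {x} δ 0<δ h =
  δ , 0<δ , ev-map (λ i → ≡.subst (ℚ._≤ seq x i) (≡.sym (ℚ.+-identityˡ δ))) h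

pointwise-nonneg : ∀ {x} → Eventually (λ i → 0ℚ ℚ.≤ seq x i) → Nonnegative x
pointwise-nonneg {x} h ε 0<ε = ev-map (λ i 0≤x → ℚ.+-mono-≤ 0≤x (ℚ.<⇒≤ 0<ε)) h

positive-resp : ∀ {x y} → x ≃ y → Positive x → Positive y
positive-resp {x} {y} x≃y pos =
  let δ , 0<δ , h = positive-elim {x} pos in
  positive-intro {y} (½ ℚ.* δ) (half-pos 0<δ) (ev-map
    (λ i (δ≤x , x≈y) → ≤-from ((seq x i ℚ.- δ) ℚ.+ (seq y i ℚ.+ ½ ℚ.* δ ℚ.- seq x i))
      (solve 3 (λ x y d → (x :- d) :+ (y :+ con ½ :* d :- x) := y :- con ½ :* d) ≡.refl
        (seq x i) (seq y i) δ)
      (ℚ.+-mono-≤ (≤⇒0≤difference δ≤x) (≤⇒0≤difference (close (seq x i) (seq y i) x≈y))))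
    (h ∧ᵉ x≃y (½ ℚ.* δ) (half-pos 0<δ)))

nonnegative-resp : ∀ {x y} → x ≃ y → Nonnegative x → Nonnegative y
nonnegative-resp {x} {y} x≃y nn ε 0<ε = ev-map
  (λ i (0≤x , x≈y) → ≤-from
    ((seq x i ℚ.+ ½ ℚ.* ε) ℚ.+ (seq y i ℚ.+ ½ ℚ.* ε ℚ.- seq x i))
    (solve 3 (λ x y e → (x :+ con ½ :* e) :+ (y :+ con ½ :* e :- x) := y :+ e :- con 0ℚ) ≡.refl
      (seq x i) (seq y i) ε)
    (ℚ.+-mono-≤ 0≤x (≤⇒0≤difference (close (seq x i) (seq y i) x≈y))))
  (nn (½ ℚ.* ε) (half-pos 0<ε) ∧ᵉ x≃y (½ ℚ.* ε) (half-pos 0<ε))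

nonnegative-+ : ∀ {x y} → Nonnegative x → Nonnegative y → Nonnegative (x + y)
nonnegative-+ {x} {y} h k ε 0<ε = ev-map
  (λ i (p , q) → ≡.subst (0ℚ ℚ.≤_)
    (solve 3 (λ x y e → (x :+ con ½ :* e) :+ (y :+ con ½ :* e) := x :+ y :+ e) ≡.refl
      (seq x i) (seq y i) ε)
    (ℚ.+-mono-≤ p q))
  (h (½ ℚ.* ε) (half-pos 0<ε) ∧ᵉ k (½ ℚ.* ε) (half-pos 0<ε))

positive-+-nonnegative : ∀ {x y} → Positive x → Nonnegative y → Positive (x + y)
positive-+-nonnegative {x} {y} pos nn =
  let δ , 0<δ , h = positive-elim {x} pos in
  positive-intro {x + y} (½ ℚ.* δ) (half-pos 0<δ) (ev-map
    (λ i (δ≤x , 0≤y) → ≤-from ((seq x i ℚ.- δ) ℚ.+ (seq y i ℚ.+ ½ ℚ.* δ))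
      (solve 3 (λ x y d → (x :- d) :+ (y :+ con ½ :* d) := x :+ y :- con ½ :* d) ≡.refl
        (seq x i) (seq y i) δ)
      (ℚ.+-mono-≤ (≤⇒0≤difference δ≤x) 0≤y))
    (h ∧ᵉ nn (½ ℚ.* δ) (half-pos 0<δ)))

positive-* : ∀ {x y} → Positive x → Positive y → Positive (x * y)
positive-* {x} {y} px py =
  let δ , 0<δ , h = positive-elim {x} px
      η , 0<η , k = positive-elim {y} py
  in positive-intro {x * y} (δ ℚ.* η) (*-pos 0<δ 0<η) (ev-map
    (λ i (δ≤x , η≤y) → ℚ.≤-trans
      (ℚ.*-monoʳ-≤-nonNeg η {{ℚ.nonNegative (ℚ.<⇒≤ 0<η)}} δ≤x)
      (ℚ.*-monoˡ-≤-nonNeg (seq x i) {{ℚ.nonNegative (ℚ.≤-trans (ℚ.<⇒≤ 0<δ) δ≤x)}} η≤y))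
    (h ∧ᵉ k))

-- Approximations of y may be as low as -η, which costs the product at most Bη = ½ε when x ≤ B.
positive-*-nonnegative : ∀ {x y} → Positive x → Nonnegative y → Nonnegative (x * y)
positive-*-nonnegative {x} {y} pos nn ε 0<ε =
  let δ , 0<δ , h   = positive-elim {x} pos
      B , 0<B , x≤B = bounded {seq x} (cauchy x)
      η , 0<η , Bη  = shrink 0<B 0<ε
  in ev-map
    (λ i (δ≤x , ∣x∣≤B , 0≤y+η) → ≡.subst (0ℚ ℚ.≤_)
      (≡.trans
        (solve 5 (λ x y n b e → x :* (y :+ n) :+ (b :- x) :* n :+ con ½ :* e
          := x :* y :+ (b :* n :+ con ½ :* e)) ≡.refl (seq x i) (seq y i) η B ε)
        (≡.cong (seq x i ℚ.* seq y i ℚ.+_)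
          (≡.trans (≡.cong (ℚ._+ ½ ℚ.* ε) Bη) (half+half ε))))
      (ℚ.+-mono-≤ (ℚ.+-mono-≤
        (*-nonneg (ℚ.≤-trans (ℚ.<⇒≤ 0<δ) δ≤x) 0≤y+η)
        (*-nonneg (≤⇒0≤difference (ℚ.≤-trans (p≤∣p∣ (seq x i)) ∣x∣≤B)) (ℚ.<⇒≤ 0<η)))
        (ℚ.<⇒≤ (half-pos 0<ε))))
    (h ∧ᵉ x≤B ∧ᵉ nn η 0<η)

∣-0∣ : ∀ p → ∣ p ℚ.- 0ℚ ∣ ≡ ∣ p ∣
∣-0∣ p = ≡.cong ∣_∣ (solve 1 (λ p → p :- con 0ℚ := p) ≡.refl p)

nonnegative-antisym : ∀ {x} → Nonnegative x → Nonnegative (-ℝ x) → x ≃ 0ℝ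
nonnegative-antisym {x} h k ε 0<ε = ev-map
  (λ i (p , q) → ≡.subst (ℚ._< ε) (≡.sym (∣-0∣ (seq x i))) (ℚ.≤-<-trans
    (∣∣≤ (≤-from _ (solve 2 (λ x e → :- x :+ e := e :- x) ≡.refl (seq x i) (½ ℚ.* ε)) q)
         (≤-from _ (solve 2 (λ x e → x :+ e := e :- :- x) ≡.refl (seq x i) (½ ℚ.* ε)) p))
    (half< 0<ε)))
  (h (½ ℚ.* ε) (half-pos 0<ε) ∧ᵉ k (½ ℚ.* ε) (half-pos 0<ε))

positive-asym : ∀ {x} → Positive x → ¬ Nonnegative (-ℝ x)
positive-asym {x} pos nn =
  let δ , 0<δ , h = positive-elim {x} pos
      N , both    = h ∧ᵉ nn (½ ℚ.* δ) (half-pos 0<δ)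
      δ≤x , 0≤-x  = both N ℕ.≤-refl
  in ℚ.<-irrefl ≡.refl (ℚ.<-≤-trans (half< 0<δ) (≤-from _
    (solve 2 (λ x d → (x :- d) :+ (:- x :+ con ½ :* d) := con ½ :* d :- d) ≡.refl (seq x N) δ)
    (ℚ.+-mono-≤ (≤⇒0≤difference δ≤x) 0≤-x)))

positive-*-cancel : ∀ {x y} → Positive x → x * y ≃ 0ℝ → y ≃ 0ℝ
positive-*-cancel {x} {y} pos xy≃0 ε 0<ε =
  let δ , 0<δ , h = positive-elim {x} pos in
  ev-map
    (λ i (δ≤x , xy<) → ≡.subst (ℚ._< ε) (≡.sym (∣-0∣ (seq y i)))
      (ℚ.*-cancelˡ-<-nonNeg δ {{ℚ.nonNegative (ℚ.<⇒≤ 0<δ)}} (ℚ.≤-<-trans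
        (ℚ.*-monoʳ-≤-nonNeg ∣ seq y i ∣ {{ℚ.nonNegative (ℚ.0≤∣p∣ (seq y i))}}
          (ℚ.≤-trans δ≤x (p≤∣p∣ (seq x i))))
        (≡.subst (ℚ._< δ ℚ.* ε)
          (≡.trans (∣-0∣ (seq x i ℚ.* seq y i)) (ℚ.∣p*q∣≡∣p∣*∣q∣ (seq x i) (seq y i))) xy<))))
    (h ∧ᵉ xy≃0 (δ ℚ.* ε) (*-pos 0<δ 0<ε))

ℝ-square-cancel : ∀ {x} → x * x ≃ 0ℝ → x ≃ 0ℝ
ℝ-square-cancel {x} x²≃0 ε 0<ε = ev-map
  (λ i x²< → ≡.subst (ℚ._< ε) (≡.sym (∣-0∣ (seq x i))) (ℚ.≰⇒> λ ε≤x →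
    ℚ.<-irrefl ≡.refl (ℚ.<-≤-trans
      (≡.subst (ℚ._< ε ℚ.* ε)
        (≡.trans (∣-0∣ (seq x i ℚ.* seq x i)) (ℚ.∣p*q∣≡∣p∣*∣q∣ (seq x i) (seq x i))) x²<)
      (ℚ.≤-trans (ℚ.*-monoʳ-≤-nonNeg ε {{ℚ.nonNegative (ℚ.<⇒≤ 0<ε)}} ε≤x)
        (ℚ.*-monoˡ-≤-nonNeg ∣ seq x i ∣ {{ℚ.nonNegative (ℚ.0≤∣p∣ (seq x i))}} ε≤x)))))
  (x²≃0 (ε ℚ.* ε) (*-pos 0<ε 0<ε))

ℝ-algebra : OrderedAlgebra
ℝ-algebra = record
  { commutativeRing = ℝ-commutativeRing
  ; ι     = fromℚ
  ; ι-+   = λ p q → pointwise {fromℚ (p ℚ.+ q)} {fromℚ p + fromℚ q} λ _ → ≡.refl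
  ; ι-*   = λ p q → pointwise {fromℚ (p ℚ.* q)} {fromℚ p * fromℚ q} λ _ → ≡.refl
  ; ι-neg = λ p → pointwise {fromℚ (ℚ.- p)} { -ℝ fromℚ p} λ _ → ≡.refl
  ; ι-0   = pointwise {0ℝ} {0ℝ} λ _ → ≡.refl
  ; ι-1   = pointwise {1ℝ} {1ℝ} λ _ → ≡.refl
  ; Pos = Positive ; Nonneg = Nonnegative
  ; pos-resp = λ {x} {y} → positive-resp {x} {y}
  ; nonneg-resp = λ {x} {y} → nonnegative-resp {x} {y}
  ; pos-ι = λ {q} 0<q → positive-intro {fromℚ q} q 0<q (always λ _ → ℚ.≤-refl)
  ; pos⇒nonneg = λ {x} pos → let δ , 0<δ , h = positive-elim {x} pos in
      pointwise-nonneg {x} (ev-map (λ i → ℚ.≤-trans (ℚ.<⇒≤ 0<δ)) h)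
  ; pos-+-nonneg = λ {x} {y} → positive-+-nonnegative {x} {y}
  ; nonneg-+ = λ {x} {y} → nonnegative-+ {x} {y}
  ; pos-* = λ {x} {y} → positive-* {x} {y}
  ; pos-*-nonneg = λ {x} {y} → positive-*-nonnegative {x} {y}
  ; square-nonneg = λ x → pointwise-nonneg {x * x} (always λ i → ℚ-square-nonneg (seq x i))
  ; nonneg-antisym = λ {x} → nonnegative-antisym {x}
  ; pos-asym = λ {x} → positive-asym {x}
  ; pos-*-cancel = λ {x} {y} → positive-*-cancel {x} {y}
  ; square-cancel = λ {x} → ℝ-square-cancel {x}
  }

far-below : ∀ x z {η} → ∣ x ℚ.- z ∣ ℚ.< η → z ℚ.- η ℚ.≤ x
far-below x z {η} h = ≤-from _
  (solve 3 (λ x z e → x :+ e :- z := x :- (z :- e)) ≡.refl x z η) (≤⇒0≤difference (close′ x z h))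

-- A decidable substitute for trichotomy: one approximation of accuracy ¼ε is compared with ½ε. If
-- it is at least ½ε, all later ones are at least ¼ε; otherwise they are at most ¾ε.
approximate-sign : ∀ x ε → 0ℚ ℚ.< ε → Positive x ⊎ Eventually (λ i → seq x i ℚ.≤ ε)
approximate-sign x ε 0<ε with cauchy x (½ ℚ.* (½ ℚ.* ε)) (half-pos (half-pos 0<ε))
... | N , h with ½ ℚ.* ε ℚ.≤? seq x N
...   | yes η≤x = inj₁ (positive-intro {x} (½ ℚ.* (½ ℚ.* ε)) (half-pos (half-pos 0<ε))
          (N , λ i N≤i → ℚ.≤-trans
            (≤-from _ (solve 2 (λ x e → x :- con ½ :* e
                := x :- con ½ :* (con ½ :* e) :- con ½ :* (con ½ :* e)) ≡.refl (seq x N) ε)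
              (≤⇒0≤difference η≤x))
            (far-below (seq x i) (seq x N) (h i N N≤i ℕ.≤-refl))))
...   | no η≰x = inj₂ (N , λ i N≤i → begin
          seq x i                             ≤⟨ close (seq x i) (seq x N) (h i N N≤i ℕ.≤-refl) ⟩
          seq x N ℚ.+ ½ ℚ.* (½ ℚ.* ε)         ≤⟨ ℚ.+-mono-≤ (ℚ.<⇒≤ (ℚ.≰⇒> η≰x))
                                                   (ℚ.<⇒≤ (half< (half-pos 0<ε))) ⟩
          ½ ℚ.* ε ℚ.+ ½ ℚ.* ε                 ≡⟨ half+half ε ⟩
          ε ∎)
  where open ℚ.≤-Reasoning

-- For each ε, `approximate-sign` leaves only the bound -z ≤ ε. So the weak order amounts to a
-- negation, and double negations can be removed in front of it.
nonnegative-stable : ∀ z → ¬ Positive (-ℝ z) → Nonnegative z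
nonnegative-stable z ¬neg ε 0<ε = [ (λ neg → contradiction neg ¬neg)
  , ev-map (λ i -z≤ε → ≡.subst (0ℚ ℚ.≤_)
      (solve 2 (λ z e → e :- :- z := z :+ e) ≡.refl (seq z i) ε) (≤⇒0≤difference -z≤ε)) ]′
  (approximate-sign (-ℝ z) ε 0<ε)

-- If x is neither positive nor negative, stability gives x ≥ 0 and -x ≥ 0, hence x ≃ 0; the three
-- cases cannot all be refuted.
¬¬sign : ∀ x → ¬ ¬ (Positive x ⊎ x ≃ 0ℝ ⊎ Positive (-ℝ x))
¬¬sign x k = k (inj₂ (inj₁ (nonnegative-antisym {x}
  (nonnegative-stable x (k ∘ inj₂ ∘ inj₂))
  (nonnegative-stable (-ℝ x) (k ∘ inj₁ ∘ positive-resp { -ℝ (-ℝ x)} {x}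
    (pointwise { -ℝ (-ℝ x)} {x} λ i → solve 1 (λ x → :- (:- x) := x) ≡.refl (seq x i)))))))


ℝ-model : RealModel
ℝ-model = record
  { algebra = ℝ-algebra
  ; at = seq
  ; at-ι = λ _ _ → ≡.refl ; at-0 = λ _ → ≡.refl ; at-1 = λ _ → ≡.refl
  ; at-+ = λ _ _ _ → ≡.refl ; at-* = λ _ _ _ → ≡.refl ; at-neg = λ _ _ → ≡.refl
  ; pos-at = λ {x} → positive-elim {x}
  ; nonneg-at = id
  ; at-nonneg = λ {x} h → pointwise-nonneg {x} (always h)
  ; at-bounded = λ x → bounded {seq x} (cauchy x)
  ; pointwise-≈ = λ {x} {y} → pointwise {x} {y}
  ; ¬¬sign = ¬¬sign
  }

-- Eigenvalues of the adjacency matrix over ℝ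

seq-sum : ∀ {n} (f : Vector ℝ n) (g : Vector ℚ n) k → (∀ i → seq (f i) k ≡ g i) →
  seq (sum f) k ≡ Q.sum g
seq-sum {zero}  f g k h = ≡.refl
seq-sum {suc n} f g k h = ≡.cong₂ ℚ._+_ (h zero) (seq-sum (tail f) (tail g) k (h ∘ suc))

module _ {n} (G : SimpleGraph n) where
  open SimpleGraph G

  seq-entry : ∀ i j k → seq (adjacencyMatrix G i j) k ≡ Q.Adjacency.A G i j
  seq-entry i j k with adj? i j
  ... | yes _ = ≡.refl
  ... | no  _ = ≡.refl

  seq-*ᵥ : ∀ x i k → seq ((adjacencyMatrix G *ᵥ x) i) k ≡ (Q.Adjacency.A G Q.· (λ j → seq (x j) k)) i
  seq-*ᵥ x i k = seq-sum (λ j → adjacencyMatrix G i j * x j)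
    (λ j → Q.Adjacency.A G i j ℚ.* seq (x j) k) k
    (λ j → ≡.cong (ℚ._* seq (x j) k) (seq-entry i j k))

  private module Spec = Spectrum ℝ-model G (adjacencyMatrix G *ᵥ_) seq-*ᵥ

  -- Since a positive gap is refuted, `approximate-sign` bounds the gap by any given ε.
  eigenvalue-square-bound : ∀ μ → IsEigenvalue (adjacencyMatrix G) μ →
    μ * μ + μ ≤ fromℕ (2 ℕ.* numEdges G)
  eigenvalue-square-bound μ (v , v≄0 , Av≃μv) ε 0<ε =
    [ (λ pos → contradiction pos
        (Spec.act-eigenvalue-bound μ v v≄0 Av≃μv))
    , ev-map (λ i gap≤ε → ≤-from (ε ℚ.- (seq (μ * μ + μ) i ℚ.- natℚ (2 ℕ.* numEdges G)))
        (solve 3 (λ a b e → e :- (a :- b) := b :+ e :- a) ≡.refl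
          (seq (μ * μ + μ) i) (natℚ (2 ℕ.* numEdges G)) ε) (≤⇒0≤difference gap≤ε)) ]′
    (approximate-sign (μ * μ + μ + -ℝ fromℕ (2 ℕ.* numEdges G)) ε 0<ε)

  top-isEigenvalue : (b : Bracketing (Q.Adjacency.A G)) →
    ¬ ¬ IsEigenvalue (adjacencyMatrix G) (mkℝ (Bracketing.upper b) (Bracketing.upper-cauchy b))
  top-isEigenvalue b = Spec.top-eigenvalue b
    (mkℝ (Bracketing.upper b) (Bracketing.upper-cauchy b)) (λ _ → ≡.refl)

  -- By stability one may assume μ < 1 and aim at absurdity. The doubly negated eigenvalue is then
  -- available, and 1 ≤ top ≤ μ contradicts the assumption.
  largest-eigenvalue≥1 : ∀ {i j} → Adj i j → ∀ μ →
    (∀ ev → IsEigenvalue (adjacencyMatrix G) ev → ev ≤ μ) → 1ℝ ≤ μ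
  largest-eigenvalue≥1 a μ largest ε 0<ε = ev-map
    (λ i → ≤-from _ (solve 2 (λ m e → m :+ :- con 1ℚ :+ e := m :+ e :- con 1ℚ) ≡.refl (seq μ i) ε))
    (nonnegative-stable (μ + -ℝ 1ℝ) (λ neg → top-isEigenvalue b λ eig →
      positive-asym { -ℝ (μ + -ℝ 1ℝ)} neg (difference-nonneg (largest (mkℝ upper upper-cauchy) eig))) ε 0<ε)
    where
    b : Bracketing (Q.Adjacency.A G)
    b = adjacency-bracketing G a
    open Bracketing b
    difference-nonneg : mkℝ upper upper-cauchy ≤ μ → Nonnegative (-ℝ (-ℝ (μ + -ℝ 1ℝ)))
    difference-nonneg h η 0<η = ev-map (λ k top≤μ → ≡.subst (0ℚ ℚ.≤_)
      (solve 3 (λ m u e → (m :+ e :- u) :+ (u :- con 1ℚ) := :- (:- (m :- con 1ℚ)) :+ e) ≡.refl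
        (seq μ k) (upper k) η)
      (ℚ.+-mono-≤ (≤⇒0≤difference top≤μ) (≤⇒0≤difference (1≤upper k))))
      (h η 0<η)

-- Colourings

module _ {n : ℕ} (G : SimpleGraph n) where
  open SimpleGraph G

  -- Oriented edges. They are counted because the colour pairs (a , b) and (b , a) must receive
  -- different objects.
  Dart : Set
  Dart = Fin (numEdges G) ⊎ Fin (numEdges G)

  endpoints : Dart → Fin n × Fin n
  endpoints (inj₁ e) = lookup (edges G) e
  endpoints (inj₂ e) = swap (lookup (edges G) e)

  edge-index : ∀ {i j} → i Fin.< j → Adj i j → ∃[ e ] lookup (edges G) e ≡ (i , j)
  edge-index {i} {j} i<j a = Any.index member , ≡.sym (Any.lookup-index member)
    where
    member : (i , j) ∈ edges G
    member = ∈-filter⁺ _ (∈-cartesianProduct⁺ (∈-allFin i) (∈-allFin j)) (i<j , a)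

  dart : ∀ {i j} → Adj i j → ∃[ d ] endpoints d ≡ (i , j)
  dart {i} {j} a with Fin.<-cmp i j
  ... | tri< i<j _ _ = let e , eq = edge-index i<j a in inj₁ e , eq
  ... | tri≈ _ ≡.refl _ = contradiction a (irrefl i)
  ... | tri> _ _ j<i = let e , eq = edge-index j<i (symm a) in inj₂ e , ≡.cong swap eq

  some-edge : 1 ≤ℕ numEdges G → ∃[ i ] ∃[ j ] Adj i j
  some-edge m≥1 with edges G in eq
  ... | (i , j) ∷ _ = i , j , proj₂ (proj₂ (∈-filter⁻ _ {xs = cartesianProduct (allFin n) (allFin n)}
          (≡.subst ((i , j) ∈_) (≡.sym eq) (Any.here ≡.refl))))

  module _ {k : ℕ} (c : Fin n → Fin (suc k)) (proper : ∀ i j → Adj i j → c i ≢ c j) where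

    Joined : Fin (suc k) → Fin (suc k) → Set
    Joined a b = ∃[ i ] ∃[ j ] (Adj i j × c i ≡ a × c j ≡ b)

    joined? : ∀ a b → Dec (Joined a b)
    joined? a b = Fin.any? λ i → Fin.any? λ j → adj? i j ×-dec (c i Fin.≟ a) ×-dec (c j Fin.≟ b)

    -- Replacing colour a by b everywhere stays proper because no edge joins the two classes. Colour
    -- a is then free, and `punchOut` closes the gap in the palette.
    merge : ∀ {a b} → a ≢ b → ¬ Joined a b → Colorable G k
    merge {a} {b} a≢b unjoined = (λ i → punchOut (avoids i)) , λ i j adj eq →
      clash i j adj (Fin.punchOut-injective (avoids i) (avoids j) eq)
      where
      recolor : Fin n → Fin (suc k)
      recolor i with c i Fin.≟ a
      ... | yes _ = b
      ... | no  _ = c i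
      avoids : ∀ i → a ≢ recolor i
      avoids i with c i Fin.≟ a
      ... | yes _    = a≢b
      ... | no  ci≢a = ci≢a ∘ ≡.sym
      clash : ∀ i j → Adj i j → recolor i ≢ recolor j
      clash i j adj with c i Fin.≟ a | c j Fin.≟ a
      ... | yes ci≡a | yes cj≡a = λ _ → proper i j adj (≡.trans ci≡a (≡.sym cj≡a))
      ... | yes ci≡a | no  _    = λ b≡cj → unjoined (i , j , adj , ci≡a , ≡.sym b≡cj)
      ... | no  _    | yes cj≡a = λ ci≡b → unjoined (j , i , symm adj , cj≡a , ci≡b)
      ... | no  _    | no  _    = proper i j adj

    module _ (minimal : ∀ l → Colorable G l → suc k ≤ℕ l) where

      joined : ∀ {a b} → a ≢ b → Joined a b
      joined {a} {b} a≢b with joined? a b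
      ... | yes j = j
      ... | no ¬j = contradiction (minimal k (merge a≢b ¬j)) ℕ.1+n≰n

      -- Ordered pairs of distinct colours: the second is numbered among the k colours other than
      -- the first, which fixes the count at (k + 1) k.
      ColorPair : Set
      ColorPair = Fin (suc k) × Fin k

      colors : ColorPair → Fin (suc k) × Fin (suc k)
      colors (a , b) = a , punchIn a b

      colors-injective : Injective _≡_ _≡_ colors
      colors-injective {a , b} {a′ , b′} eq with ≡.cong proj₁ eq
      ... | ≡.refl = ≡.cong (a ,_) (Fin.punchIn-injective a b b′ (≡.cong proj₂ eq))

      pair-dart : ∀ p → ∃[ d ] (c (proj₁ (endpoints d)) , c (proj₂ (endpoints d))) ≡ colors p
      pair-dart (a , b) =
        let i , j , adj , ci≡a , cj≡b = joined (Fin.punchInᵢ≢i a b ∘ ≡.sym)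
            d , eq = dart adj
        in d , ≡.trans (≡.cong (λ (i , j) → c i , c j) eq) (≡.cong₂ _,_ ci≡a cj≡b)

      -- The colours at the two ends of a dart recover the pair for which it was chosen.
      pair-dart-injective : Injective _≡_ _≡_ (proj₁ ∘ pair-dart)
      pair-dart-injective {p} {q} eq = colors-injective (≡.trans (≡.sym (proj₂ (pair-dart p)))
        (≡.trans (≡.cong (λ d → c (proj₁ (endpoints d)) , c (proj₂ (endpoints d))) eq)
          (proj₂ (pair-dart q))))

      code : Fin (suc k ℕ.* k) → Fin (numEdges G ℕ.+ numEdges G)
      code p = join _ _ (proj₁ (pair-dart (remQuot k p)))

      code-injective : Injective _≡_ _≡_ code
      code-injective {p} {q} eq = begin
        p                               ≡⟨ ≡.sym (Fin.combine-remQuot {suc k} k p) ⟩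
        _                               ≡⟨ ≡.cong (λ (a , b) → combine a b) same-pair ⟩
        _                               ≡⟨ Fin.combine-remQuot {suc k} k q ⟩
        q ∎
        where
        open ≡.≡-Reasoning
        same-pair : remQuot {suc k} k p ≡ remQuot k q
        same-pair = pair-dart-injective (≡.trans (≡.sym (Fin.splitAt-join _ _ _))
          (≡.trans (≡.cong (splitAt (numEdges G)) eq) (Fin.splitAt-join _ _ _)))

      color-pairs≤2m : suc k ℕ.* k ≤ℕ 2 ℕ.* numEdges G
      color-pairs≤2m = ≡.subst (suc k ℕ.* k ≤ℕ_)
        (≡.cong (numEdges G ℕ.+_) (≡.sym (ℕ.+-identityʳ (numEdges G))))
        (Fin.injective⇒≤ code-injective)

-- From the two bounds to the quotient

chromatic-product-bound : ∀ {n} (G : SimpleGraph n) {k} → IsChromaticNumber G (suc k) →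
  natℚ (suc k) ℚ.* natℚ k ℚ.≤ natℚ (2 ℕ.* numEdges G)
chromatic-product-bound G {k} ((c , proper) , minimal) =
  ≡.subst (ℚ._≤ natℚ (2 ℕ.* numEdges G)) (natℚ-* (suc k) k) (natℚ-mono (color-pairs≤2m G c proper minimal))

-- Comparing a real μ with χ - 1 is undecidable, so the case distinction is made for each rational
-- approximation separately, carrying along the error ε of the eigenvalue bound.
product-bound : ∀ {K K-1 M μ ε} → K ≡ 1ℚ ℚ.+ K-1 → 0ℚ ℚ.≤ K → 0ℚ ℚ.≤ ε → 0ℚ ℚ.≤ μ →
  K ℚ.* K-1 ℚ.≤ M → μ ℚ.* μ ℚ.+ μ ℚ.≤ M ℚ.+ ε → K ℚ.* μ ℚ.≤ M ℚ.+ ε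
product-bound {K} {K-1} {M} {μ} {ε} K≡ 0≤K 0≤ε 0≤μ KK≤M μμ≤M with ℚ.≤-total μ K-1
... | inj₁ μ≤ = begin
    K ℚ.* μ    ≤⟨ ℚ.*-monoˡ-≤-nonNeg K {{ℚ.nonNegative 0≤K}} μ≤ ⟩
    K ℚ.* K-1  ≤⟨ KK≤M ⟩
    M          ≡⟨ ≡.sym (ℚ.+-identityʳ M) ⟩
    M ℚ.+ 0ℚ   ≤⟨ ℚ.+-monoʳ-≤ M 0≤ε ⟩
    M ℚ.+ ε ∎
  where open ℚ.≤-Reasoning
... | inj₂ ≤μ = begin
    K ℚ.* μ              ≡⟨ ≡.cong (ℚ._* μ) K≡ ⟩
    (1ℚ ℚ.+ K-1) ℚ.* μ   ≤⟨ ℚ.*-monoʳ-≤-nonNeg μ {{ℚ.nonNegative 0≤μ}} (ℚ.+-monoʳ-≤ 1ℚ ≤μ) ⟩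
    (1ℚ ℚ.+ μ) ℚ.* μ     ≡⟨ solve 1 (λ m → (con 1ℚ :+ m) :* m := m :* m :+ m) ≡.refl μ ⟩
    μ ℚ.* μ ℚ.+ μ        ≤⟨ μμ≤M ⟩
    M ℚ.+ ε ∎
  where open ℚ.≤-Reasoning

-- With β = μN / M the quotient N / β is M / μ. Dividing the error ½ε by μ ≥ ½ leaves at most ε.
fraction-bound : ∀ {K N M μ ε} → 0ℚ ℚ.< N → 0ℚ ℚ.< M → 0ℚ ℚ.< ε → ½ ℚ.≤ μ →
  K ℚ.* μ ℚ.≤ M ℚ.+ ½ ℚ.* ε → K ℚ.≤ N ℚ.* inv (μ ℚ.* N ℚ.* inv M) ℚ.+ ε
fraction-bound {K} {N} {M} {μ} {ε} 0<N 0<M 0<ε ½≤μ h =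
  ℚ.*-cancelʳ-≤-pos μ {{ℚ.positive 0<μ}} (begin
    K ℚ.* μ                          ≤⟨ h ⟩
    M ℚ.+ ½ ℚ.* ε                    ≤⟨ ℚ.+-monoʳ-≤ M (ℚ.*-monoʳ-≤-nonNeg ε
                                          {{ℚ.nonNegative (ℚ.<⇒≤ 0<ε)}} ½≤μ) ⟩
    M ℚ.+ μ ℚ.* ε                    ≡⟨ ≡.cong (ℚ._+ μ ℚ.* ε) (≡.sym tμ≡M) ⟩
    N ℚ.* u ℚ.* μ ℚ.+ μ ℚ.* ε        ≡⟨ solve 3 (λ t m e → t :* m :+ m :* e := (t :+ e) :* m) ≡.refl
                                         (N ℚ.* u) μ ε ⟩
    (N ℚ.* u ℚ.+ ε) ℚ.* μ ∎)
  where
  open ℚ.≤-Reasoning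
  w β u : ℚ
  w = inv M
  β = μ ℚ.* N ℚ.* w
  u = inv β
  0<μ : 0ℚ ℚ.< μ
  0<μ = ℚ.<-≤-trans (ℚ.positive⁻¹ ½) ½≤μ
  Mw≡1 : M ℚ.* w ≡ 1ℚ
  Mw≡1 = inv-inverse M (pos⇒≢0 0<M)
  Mβ≡ : M ℚ.* β ≡ μ ℚ.* N
  Mβ≡ = ≡.trans (solve 4 (λ M m N w → M :* (m :* N :* w) := (M :* w) :* (m :* N)) ≡.refl M μ N w)
    (≡.trans (≡.cong (ℚ._* (μ ℚ.* N)) Mw≡1) (ℚ.*-identityˡ (μ ℚ.* N)))
  β≢0 : β ≢ 0ℚ
  β≢0 β≡0 = pos⇒≢0 (*-pos 0<μ 0<N) (≡.trans (≡.sym Mβ≡) (≡.trans (≡.cong (M ℚ.*_) β≡0) (ℚ.*-zeroʳ M)))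
  tμ≡M : N ℚ.* u ℚ.* μ ≡ M
  tμ≡M = ≡.trans (solve 3 (λ N u m → N :* u :* m := m :* N :* u) ≡.refl N u μ)
    (≡.trans (≡.cong (ℚ._* u) (≡.sym Mβ≡)) (≡.trans (ℚ.*-assoc M β u)
      (≡.trans (≡.cong (M ℚ.*_) (inv-inverse β β≢0)) (ℚ.*-identityʳ M))))

natℚ-pos : ∀ {k} → 1 ≤ℕ k → 0ℚ ℚ.< natℚ k
natℚ-pos 1≤k = ℚ.<-≤-trans (ℚ.positive⁻¹ 1ℚ) (natℚ-mono 1≤k)

inv-pos : ∀ {p} → 0ℚ ℚ.< p → 0ℚ ℚ.< inv p
inv-pos {p} 0<p with p ℚ.≟ 0ℚ
... | yes p≡0 = contradiction p≡0 (pos⇒≢0 0<p)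
... | no  p≢0 = ℚ.positive⁻¹ _ {{ℚ.1/pos⇒pos p {{ℚ.positive 0<p}}}}

theorem1 : (n : ℕ) (G : SimpleGraph n) (m≥1 : 1 ≤ℕ numEdges G)
    (μ : ℝ) → IsLargestEigenvalue (adjacencyMatrix G) μ →
    (χ : ℕ) → IsChromaticNumber G χ →
    let β = irregularity G m≥1 μ in
    Σ[ β#0 ∈ β # 0ℝ ] (fromℕ χ ≤ fromℕ n / β [ β#0 ])
-- No vertex can be coloured with 0 colours, and an edge has endpoints.
theorem1 n G m≥1 μ largest zero ((c , _) , _) =
  contradiction (c (proj₁ (some-edge G m≥1))) λ ()
theorem1 n G m≥1 μ (eigenvalue , largest) (suc k) chromatic =
    -- Approximations of μ are eventually at least ½, so those of β = μN / M are at least ½ N / M.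
    inj₂ (½ ℚ.* (N ℚ.* inv M) , half-pos (*-pos 0<N (inv-pos 0<M)) , ev-map β-bound ½≤μ)
  , λ ε 0<ε → ev-map
      (λ i (½≤μᵢ , μ²+μ≤) → fraction-bound 0<N 0<M 0<ε ½≤μᵢ
        (product-bound (natℚ-+ 1 k) (natℚ-nonneg (suc k)) (ℚ.<⇒≤ (half-pos 0<ε))
          (ℚ.≤-trans (ℚ.nonNegative⁻¹ ½) ½≤μᵢ) (chromatic-product-bound G chromatic) μ²+μ≤))
      (½≤μ ∧ᵉ eigenvalue-square-bound G μ eigenvalue (½ ℚ.* ε) (half-pos 0<ε))
  where
  N M : ℚ
  N = natℚ n
  M = natℚ (2 ℕ.* numEdges G)
  0<N : 0ℚ ℚ.< N
  0<N = natℚ-pos (ℕ.≤-trans (ℕ.s≤s ℕ.z≤n) (Fin.toℕ<n (proj₁ (some-edge G m≥1))))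
  0<M : 0ℚ ℚ.< M
  0<M = natℚ-pos (ℕ.≤-trans m≥1 (ℕ.m≤n*m (numEdges G) 2))
  -- From 1 ≤ μ the approximations are eventually at least 1 - ε for each ε > 0; here ε = ½.
  ½≤μ : Eventually (λ i → ½ ℚ.≤ seq μ i)
  ½≤μ = ev-map
    (λ i 1≤μ+½ → ≤-from (seq μ i ℚ.+ ½ ℚ.- 1ℚ)
      (solve 1 (λ m → m :+ con ½ :- con 1ℚ := m :- con ½) ≡.refl (seq μ i)) (≤⇒0≤difference 1≤μ+½))
    (largest-eigenvalue≥1 G (proj₂ (proj₂ (some-edge G m≥1))) μ largest ½ (ℚ.positive⁻¹ ½))
  β-bound : ∀ i → ½ ℚ.≤ seq μ i → 0ℚ ℚ.+ ½ ℚ.* (N ℚ.* inv M) ℚ.≤ seq μ i ℚ.* N ℚ.* inv M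
  β-bound i ½≤μᵢ = begin
    0ℚ ℚ.+ ½ ℚ.* (N ℚ.* inv M)    ≡⟨ ℚ.+-identityˡ _ ⟩
    ½ ℚ.* (N ℚ.* inv M)           ≤⟨ ℚ.*-monoʳ-≤-nonNeg (N ℚ.* inv M)
                                       {{ℚ.nonNegative (ℚ.<⇒≤ (*-pos 0<N (inv-pos 0<M)))}} ½≤μᵢ ⟩
    seq μ i ℚ.* (N ℚ.* inv M)     ≡⟨ ≡.sym (ℚ.*-assoc (seq μ i) N (inv M)) ⟩
    seq μ i ℚ.* N ℚ.* inv M ∎
    where open ℚ.≤-Reasoning
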